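{- Let $G$ be the quaternion group and let $M:=R_9\oplus Q_3(G)$. Then $M$ is representable over some skew partial field, but $M$ is not representable over any skew field.
   Context: A skew partial field is a pair $\mathbb{P}=(R,G')$ with $R$ a (not necessarily commutative) ring with identity and $G'$ a subgroup of the units $R^*$ with $-1\in G'$. An $R$-chain group on a finite set $E$ is a subset of $R^E$ containing $0$ and closed under componentwise addition and left scalar multiplication. A chain $c$ is elementary in $C$ if $c\ne0$ and no nonzero chain of $C$ has support strictly contained in $\|c\|=\{e:c_e\ne0\}$; $c$ is $G'$-primitive if its entries lie in $G'\cup\{0\}$. A $\mathbb{P}$-chain group is an $R$-chain group in which every elementary chain equals $rc'$ with $r\in R$, $c'$ a $G'$-primitive chain of the group; $M(C)$ is the matroid whose cocircuits are supports of elementary chains. $M$ is representable over $\mathbb{P}$ if $M=M(C)$ for some $\mathbb{P}$-chain group $C$; $M$ is representable over a skew field $\mathbb{F}$ if it is representable over $(\mathbb{F},\mathbb{F}\setminus\{0\})$. The quaternion group $G=\{\pm1,\pm i,\pm j,\pm k\}$ has $i^2=j^2=k^2=ijk=-1$. Let $g_1,\dots,g_8$ be $1,-1,i,-i,j,-j,k,-k$. $Q_3(G)$ is the matroid on $\{e_1,e_2,e_3,a_1,\dots,a_8,b_1,\dots,b_8,c_1,\dots,c_8\}$ represented over the quaternions $\mathbb{H}$ by the $3\times27$ matrix whose column $e_t$ is the $t$-th unit vector, column $a_m$ is $(-1,g_m,0)^T$, column $b_m$ is $(0,-1,g_m)^T$, column $c_m$ is $(g_m,0,-1)^T$. $R_9$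 is the matroid on $\{1,\dots,9\}$ represented over $\mathrm{GF}(3)$ by the matrix with rows $(1,0,0,1,1,1,0,0,1)$, $(0,1,0,1,1,2,1,1,0)$, $(0,0,1,1,0,0,1,2,1)$. $\oplus$ denotes the direct sum of matroids. -}

module Defs where

open import Level using (Level; _⊔_; 0ℓ; Setω) renaming (suc to lsuc)
open import Data.Nat using (ℕ; zero; suc) renaming (_+_ to _+ℕ_)
open import Data.Fin using (Fin; splitAt) renaming (zero to f0; suc to fs)
open import Data.Fin.Subset using (Subset; _∈_) renaming (⊥ to ∅)
open import Data.Vec using (_++_)
open import Data.Product using (Σ; ∃; _×_; _,_)
open import Data.Sum using (_⊎_; inj₁; inj₂)
open import Data.Rational using (ℚ; 0ℚ; 1ℚ) renaming (_+_ to _+ℚ_; _*_ to _*ℚ_; _-_ to _-ℚ_; -_ to -ℚ_)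
open import Relation.Nullary using (¬_)
open import Relation.Binary.PropositionalEquality using (_≡_)
open import Algebra.Bundles using (Ring)
open import Function.Bundles using (_⇔_)

module Chains {a ℓ : Level} {A : Set a} (_≈_ : A → A → Set ℓ) (0# : A) where

  Chain : ℕ → Set a
  Chain n = Fin n → A

  supp : ∀ {n} → Chain n → Fin n → Set ℓ
  supp c e = ¬ (c e ≈ 0#)

  NonZeroChain : ∀ {n} → Chain n → Set ℓ
  NonZeroChain c = ∃ λ e → supp c e

  StrictSubsupport : ∀ {n} → Chain n → Chain n → Set ℓ
  StrictSubsupport d c = (∀ e → supp d e → supp c e) × (∃ λ e → supp c e × ¬ supp d e)

  Elementary : ∀ {n κ} → (Chain n → Set κ) → Chain n → Set (a ⊔ ℓ ⊔ κ)
  Elementary C c =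
    C c × NonZeroChain c ×
    (∀ d → C d → ¬ (NonZeroChain d × StrictSubsupport d c))

  IsCocircuitOf : ∀ {n κ} → (Chain n → Set κ) → Subset n → Set (a ⊔ ℓ ⊔ κ)
  IsCocircuitOf C X = ∃ λ c → Elementary C c × (∀ e → (e ∈ X) ⇔ supp c e)

-- Matroids, given by their family of cocircuits.

CocircuitFamily : ℕ → Set₁
CocircuitFamily n = Subset n → Set

_⊕_ : ∀ {m n} → CocircuitFamily m → CocircuitFamily n → CocircuitFamily (m +ℕ n)
_⊕_ {m} {n} M₁ M₂ X =
  (∃ λ Y → X ≡ Y ++ ∅ {n} × M₁ Y) ⊎ (∃ λ Z → X ≡ ∅ {m} ++ Z × M₂ Z)

module _ {c ℓ : Level} (R : Ring c ℓ) where
  open Ring R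

  IsUnit : Carrier → Set (c ⊔ ℓ)
  IsUnit x = ∃ λ y → (x * y ≈ 1#) × (y * x ≈ 1#)

  open Chains _≈_ 0#

  record IsChainGroup {n : ℕ} {κ : Level} (C : Chain n → Set κ) : Set (c ⊔ ℓ ⊔ κ) where
    field
      respects : ∀ x y → (∀ e → x e ≈ y e) → C x → C y
      has-zero : C (λ _ → 0#)
      +-closed : ∀ x y → C x → C y → C (λ e → x e + y e)
      *-closed : ∀ r x → C x → C (λ e → r * x e)

  module _ {g : Level} (G′ : Carrier → Set g) where

    Primitive : ∀ {n} → Chain n → Set (g ⊔ ℓ)
    Primitive c = ∀ e → G′ (c e) ⊎ (c e ≈ 0#)

    record IsPChainGroup {n : ℕ} {κ : Level} (C : Chain n → Set κ) : Set (c ⊔ ℓ ⊔ g ⊔ κ) where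
      field
        chainGroup : IsChainGroup C
        elementary-primitive : ∀ c → Elementary C c →
          ∃ λ r → ∃ λ c′ → C c′ × Primitive c′ × (∀ e → c e ≈ r * c′ e)

    Representable : ∀ {n} (κ : Level) → CocircuitFamily n → Set (c ⊔ ℓ ⊔ g ⊔ lsuc κ)
    Representable {n} κ M =
      Σ (Chain n → Set κ) λ C → IsPChainGroup C × (∀ X → M X ⇔ IsCocircuitOf C X)

record SkewPartialField (c ℓ g : Level) : Set (lsuc (c ⊔ ℓ ⊔ g)) where
  field
    ring : Ring c ℓ
  open Ring ring
  field
    G′ : Carrier → Set g
    G′-respects : ∀ {x y} → x ≈ y → G′ x → G′ y
    G′-units : ∀ {x} → G′ x → IsUnit ring x
    G′-one : G′ 1#
    G′-mul : ∀ {x y} → G′ x → G′ y → G′ (x * y)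
    G′-inv : ∀ {x y} → G′ x → x * y ≈ 1# → y * x ≈ 1# → G′ y
    G′-minus-one : G′ (- 1#)

record SkewField (c ℓ : Level) : Set (lsuc (c ⊔ ℓ)) where
  field
    ring : Ring c ℓ
  open Ring ring
  field
    1≉0 : ¬ (1# ≈ 0#)
    inverse : ∀ x → ¬ (x ≈ 0#) → IsUnit ring x

  NonZero : Carrier → Set ℓ
  NonZero x = ¬ (x ≈ 0#)

RepresentableOverPF : ∀ {c ℓ g n} (κ : Level) → SkewPartialField c ℓ g → CocircuitFamily n → Set _
RepresentableOverPF κ P M = Representable (SkewPartialField.ring P) (SkewPartialField.G′ P) κ M

RepresentableOverSF : ∀ {c ℓ n} (κ : Level) → SkewField c ℓ → CocircuitFamily n → Set _
RepresentableOverSF κ F M = Representable (SkewField.ring F) (SkewField.NonZero F) κ M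

module RowSpace {A : Set} (0# : A) (_+ᴬ_ _*ᴬ_ : A → A → A) where

  sumF : ∀ {r} → (Fin r → A) → A
  sumF {zero} f = 0#
  sumF {suc r} f = f f0 +ᴬ sumF (λ i → f (fs i))

  RowSpaceOf : ∀ {r n} → (Fin r → Fin n → A) → (Fin n → A) → Set
  RowSpaceOf {r} {n} Mat x = ∃ λ (y : Fin r → A) → ∀ e → x e ≡ sumF (λ i → y i *ᴬ Mat i e)

  open Chains {A = A} _≡_ 0#

  MatroidOf : ∀ {r n} → (Fin r → Fin n → A) → CocircuitFamily n
  MatroidOf Mat = IsCocircuitOf (RowSpaceOf Mat)

data 𝔽₃ : Set where
  z₃ o₃ t₃ : 𝔽₃

_+₃_ : 𝔽₃ → 𝔽₃ → 𝔽₃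
z₃ +₃ y = y
o₃ +₃ z₃ = o₃
o₃ +₃ o₃ = t₃
o₃ +₃ t₃ = z₃
t₃ +₃ z₃ = t₃
t₃ +₃ o₃ = z₃
t₃ +₃ t₃ = o₃

_*₃_ : 𝔽₃ → 𝔽₃ → 𝔽₃
z₃ *₃ y = z₃
o₃ *₃ y = y
t₃ *₃ z₃ = z₃
t₃ *₃ o₃ = t₃
t₃ *₃ t₃ = o₃

R₉-matrix : Fin 3 → Fin 9 → 𝔽₃
R₉-matrix i e = Data.Vec.lookup (Data.Vec.lookup rows i) e
  where
  open import Data.Vec using (Vec; []; _∷_)
  rows : Vec (Vec 𝔽₃ 9) 3
  rows = (o₃ ∷ z₃ ∷ z₃ ∷ o₃ ∷ o₃ ∷ o₃ ∷ z₃ ∷ z₃ ∷ o₃ ∷ [])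
       ∷ (z₃ ∷ o₃ ∷ z₃ ∷ o₃ ∷ o₃ ∷ t₃ ∷ o₃ ∷ o₃ ∷ z₃ ∷ [])
       ∷ (z₃ ∷ z₃ ∷ o₃ ∷ o₃ ∷ z₃ ∷ z₃ ∷ o₃ ∷ t₃ ∷ o₃ ∷ [])
       ∷ []

R₉ : CocircuitFamily 9
R₉ = RowSpace.MatroidOf z₃ _+₃_ _*₃_ R₉-matrix

record ℍ : Set where
  constructor quat
  field
    re im-i im-j im-k : ℚ

0ℍ : ℍ
0ℍ = quat 0ℚ 0ℚ 0ℚ 0ℚ

_+ℍ_ : ℍ → ℍ → ℍ
quat a b c d +ℍ quat a′ b′ c′ d′ = quat (a +ℚ a′) (b +ℚ b′) (c +ℚ c′) (d +ℚ d′)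

_*ℍ_ : ℍ → ℍ → ℍ
quat a₁ b₁ c₁ d₁ *ℍ quat a₂ b₂ c₂ d₂ =
  quat (((a₁ *ℚ a₂) -ℚ (b₁ *ℚ b₂)) -ℚ ((c₁ *ℚ c₂) +ℚ (d₁ *ℚ d₂)))
       (((a₁ *ℚ b₂) +ℚ (b₁ *ℚ a₂)) +ℚ ((c₁ *ℚ d₂) -ℚ (d₁ *ℚ c₂)))
       (((a₁ *ℚ c₂) -ℚ (b₁ *ℚ d₂)) +ℚ ((c₁ *ℚ a₂) +ℚ (d₁ *ℚ b₂)))
       (((a₁ *ℚ d₂) +ℚ (b₁ *ℚ c₂)) +ℚ ((d₁ *ℚ a₂) -ℚ (c₁ *ℚ b₂)))

-ℍ_ : ℍ → ℍ
-ℍ quat a b c d = quat (-ℚ a) (-ℚ b) (-ℚ c) (-ℚ d)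

1ℍ iℍ jℍ kℍ : ℍ
1ℍ = quat 1ℚ 0ℚ 0ℚ 0ℚ
iℍ = quat 0ℚ 1ℚ 0ℚ 0ℚ
jℍ = quat 0ℚ 0ℚ 1ℚ 0ℚ
kℍ = quat 0ℚ 0ℚ 0ℚ 1ℚ

quaternionGroup : Fin 8 → ℍ
quaternionGroup f0 = 1ℍ
quaternionGroup (fs f0) = -ℍ 1ℍ
quaternionGroup (fs (fs f0)) = iℍ
quaternionGroup (fs (fs (fs f0))) = -ℍ iℍ
quaternionGroup (fs (fs (fs (fs f0)))) = jℍ
quaternionGroup (fs (fs (fs (fs (fs f0))))) = -ℍ jℍ
quaternionGroup (fs (fs (fs (fs (fs (fs f0)))))) = kℍ
quaternionGroup (fs (fs (fs (fs (fs (fs (fs f0))))))) = -ℍ kℍ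

vec3 : ℍ → ℍ → ℍ → Fin 3 → ℍ
vec3 x y z f0 = x
vec3 x y z (fs f0) = y
vec3 x y z (fs (fs f0)) = z

Q₃-column : Fin 27 → Fin 3 → ℍ
Q₃-column e with splitAt 3 e
... | inj₁ t = vec3 (unit t f0) (unit t (fs f0)) (unit t (fs (fs f0)))
  where
  unit : Fin 3 → Fin 3 → ℍ
  unit f0 f0 = 1ℍ
  unit (fs f0) (fs f0) = 1ℍ
  unit (fs (fs f0)) (fs (fs f0)) = 1ℍ
  unit _ _ = 0ℍ
... | inj₂ e′ with splitAt 8 e′
...   | inj₁ m = vec3 (-ℍ 1ℍ) (quaternionGroup m) 0ℍ
...   | inj₂ e″ with splitAt 8 e″
...     | inj₁ m = vec3 0ℍ (-ℍ 1ℍ) (quaternionGroup m)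
...     | inj₂ m = vec3 (quaternionGroup m) 0ℍ (-ℍ 1ℍ)

Q₃-matrix : Fin 3 → Fin 27 → ℍ
Q₃-matrix i e = Q₃-column e i

Q₃G : CocircuitFamily 27
Q₃G = RowSpace.MatroidOf 0ℍ _+ℍ_ _*ℍ_ Q₃-matrix

M-R₉⊕Q₃ : CocircuitFamily 36
M-R₉⊕Q₃ = R₉ ⊕ Q₃G

record _∧ω_ {a : Level} (A : Set a) (B : Setω) : Setω where
  constructor _,ω_
  field
    first : A
    second : B

{-# OPTIONS --safe #-}
module Submission where

-- Both matroids are representable over H₃, the quaternions over GF(3), with all units
-- as the group: R₉ because H₃ is a GF(3)-algebra, and Q₃(G) because differences of
-- distinct elements of {±1, ±i, ±j, ±k} have norm 1, 2 or 4 and hence remain invertible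
-- in characteristic 3.  In both cases the elementary chains are the multiples of a list
-- of primitive chains whose supports do not depend on the ring.
--
-- Over a skew field, R₉ forces 3 = 0, while Q₃(G) forces a copy of the quaternion group
-- in which -1 is sent to -1.  Then (i + j)² = -2 = 1, so i + j = ±1, so i and j commute,
-- contradicting ij = -ji.
open import Defs
open import Level using (Level; 0ℓ)
open import Data.Product using (Σ)
open import Relation.Nullary using (¬_)

open import Level using (_⊔_) renaming (suc to lsuc)
open import Algebra.Bundles using (CommutativeMonoid; CommutativeRing; Ring)
import Algebra.Morphism.RingMonomorphism as RingMonomorphism
import Algebra.Properties.CommutativeSemigroup as CommutativeSemigroupProperties
import Algebra.Properties.Ring as RingProperties
import Algebra.Solver.Ring.AlmostCommutativeRing as ACR
import Algebra.Solver.Ring.Simple as Simple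
open import Algebra.Structures using (IsCommutativeRing; IsRing)
open import Data.Bool using (if_then_else_; true)
open import Data.Empty using (⊥; ⊥-elim)
open import Data.Fin using (Fin; #_; join; splitAt; suc; zero; _↑ʳ_; _↑ˡ_)
import Data.Fin.Properties as Fin
open import Data.Fin.Subset using (Subset; _∈_; _∉_; _⊂_) renaming (⊥ to ∅)
open import Data.Fin.Subset.Induction using (Acc; acc; ⊂-wellFounded)
open import Data.Fin.Subset.Properties using (Empty-unique; ∉⊥)
open import Data.Maybe using (Maybe; just; nothing)
import Data.Maybe.Properties as Maybe
open import Data.Nat using (ℕ; suc; zero) renaming (_+_ to _+ℕ_)
open import Data.Product using (∃; proj₁; proj₂; _,_; _×_)
open import Data.Rational using (ℚ; 0ℚ) renaming (_+_ to _+ℚ_)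
import Data.Rational.Properties as ℚ
open import Data.Sum using (inj₁; inj₂; [_,_]′; _⊎_)
import Data.Sum as Sum
open import Data.Vec using (Vec; []; lookup; tabulate; _++_; _∷_)
import Data.Vec as Vec
import Data.Vec.Properties as Vec
open import Function using (_∘_)
open import Function.Bundles using (Equivalence; mk⇔; _⇔_)
open import Relation.Binary.Definitions using (DecidableEquality; tri<; tri>; tri≈)
open import Relation.Binary.PropositionalEquality as ≡ using (cong; cong₂; module ≡-Reasoning; refl; subst; sym; trans; _≡_; _≢_)
import Relation.Binary.Reasoning.Setoid as SetoidReasoning
open import Relation.Nullary using (contradiction; Dec; does; no; yes)
open import Relation.Nullary.Decidable using (decidable-stable; from-yes; map′; toWitness; True; ¬?; ¬¬-excluded-middle; _×-dec_; _→-dec_; _⊎-dec_)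
open import Relation.Unary using (Decidable)

-- H₃ is not a skew field: 1 + i + j has norm 3 = 0 and is a zero divisor, so a nonzero scalar
-- cannot be cancelled in general. The description of the elementary chains of Q₃(G) therefore rests
-- on one substitute for cancellation: if r ≠ 0, then r g = r h forces g = h for group elements g
-- and h. This holds in every ring without 2-torsion that contains the group with its -1 as the -1
-- of the ring, because each group element other than 1 has -1 among its powers. Thus ℍ and H₃ can
-- share one proof.
--
-- In the other direction only the cocircuits of the chain group are known; it does not come split
-- into two summands. Dimension counting is replaced by a basis of each summand, met by all its
-- cocircuits: a chain that vanishes on both bases is zero. Collinear triples then turn into
-- equations between entries. The image of -1 has square 1, and it differs from 1 because the
-- matroid separates the points of 1 and -1 on one side; in a skew field this leaves only -1.

_≟₃_ : DecidableEquality 𝔽₃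
z₃ ≟₃ z₃ = yes refl
z₃ ≟₃ o₃ = no λ ()
z₃ ≟₃ t₃ = no λ ()
o₃ ≟₃ z₃ = no λ ()
o₃ ≟₃ o₃ = yes refl
o₃ ≟₃ t₃ = no λ ()
t₃ ≟₃ z₃ = no λ ()
t₃ ≟₃ o₃ = no λ ()
t₃ ≟₃ t₃ = yes refl

all₃? : ∀ {p} {P : 𝔽₃ → Set p} → Decidable P → Dec (∀ x → P x)
all₃? P? = map′ (λ { (a , b , c) z₃ → a ; (a , b , c) o₃ → b ; (a , b , c) t₃ → c })
                (λ f → f z₃ , f o₃ , f t₃)
                (P? z₃ ×-dec P? o₃ ×-dec P? t₃)

-- Multiplication by 2, so that closure under scalars is definitionally also closure under negation.
-₃_ : 𝔽₃ → 𝔽₃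
-₃_ = t₃ *₃_

+₃-comm : ∀ x y → x +₃ y ≡ y +₃ x
+₃-comm = from-yes (all₃? λ x → all₃? λ y → (x +₃ y) ≟₃ (y +₃ x))

*₃-comm : ∀ x y → x *₃ y ≡ y *₃ x
*₃-comm = from-yes (all₃? λ x → all₃? λ y → (x *₃ y) ≟₃ (y *₃ x))

𝔽₃-commutativeRing : CommutativeRing 0ℓ 0ℓ
𝔽₃-commutativeRing = record
  { Carrier = 𝔽₃ ; _≈_ = _≡_ ; _+_ = _+₃_ ; _*_ = _*₃_ ; -_ = -₃_ ; 0# = z₃ ; 1# = o₃
  ; isCommutativeRing = record
    { isRing = record
      { +-isAbelianGroup = record
        { isGroup = record
          { isMonoid = record
            { isSemigroup = record
              { isMagma = record { isEquivalence = ≡.isEquivalence ; ∙-cong = cong₂ _+₃_ }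
              ; assoc = from-yes (all₃? λ x → all₃? λ y → all₃? λ z → ((x +₃ y) +₃ z) ≟₃ (x +₃ (y +₃ z)))
              }
            ; identity = (λ _ → refl) , λ x → +₃-comm x z₃
            }
          ; inverse = from-yes (all₃? λ x → ((-₃ x) +₃ x) ≟₃ z₃) , from-yes (all₃? λ x → (x +₃ (-₃ x)) ≟₃ z₃)
          ; ⁻¹-cong = cong -₃_
          }
        ; comm = +₃-comm
        }
      ; *-cong = cong₂ _*₃_
      ; *-assoc = from-yes (all₃? λ x → all₃? λ y → all₃? λ z → ((x *₃ y) *₃ z) ≟₃ (x *₃ (y *₃ z)))
      ; *-identity = (λ _ → refl) , λ x → *₃-comm x o₃
      ; distrib =
          from-yes (all₃? λ x → all₃? λ y → all₃? λ z → (x *₃ (y +₃ z)) ≟₃ ((x *₃ y) +₃ (x *₃ z)))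
        , from-yes (all₃? λ x → all₃? λ y → all₃? λ z → ((y +₃ z) *₃ x) ≟₃ ((y *₃ x) +₃ (z *₃ x)))
      }
    ; *-comm = *₃-comm
    }
  }

-- Quaternions over a commutative ring

record Quaternion (A : Set) : Set where
  constructor ⟨_,_,_,_⟩
  field
    q₀ q₁ q₂ q₃ : A

open Quaternion

⟨⟩-cong : ∀ {A : Set} {a b c d a′ b′ c′ d′ : A} → a ≡ a′ → b ≡ b′ → c ≡ c′ → d ≡ d′ →
          ⟨ a , b , c , d ⟩ ≡ ⟨ a′ , b′ , c′ , d′ ⟩
⟨⟩-cong refl refl refl refl = refl

-- With only the operations as parameters, the same formulas apply to the polynomials of the ring
-- solver. Differences are written as sums with a negative, so that `toQ` is a homomorphism by
-- `refl`.
module QuaternionOps {A : Set} (_+_ _*_ : A → A → A) (-_ : A → A) where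

  infixl 6 _+q_
  infixl 7 _*q_

  _+q_ _*q_ : Quaternion A → Quaternion A → Quaternion A
  ⟨ a₁ , b₁ , c₁ , d₁ ⟩ +q ⟨ a₂ , b₂ , c₂ , d₂ ⟩ = ⟨ a₁ + a₂ , b₁ + b₂ , c₁ + c₂ , d₁ + d₂ ⟩
  ⟨ a₁ , b₁ , c₁ , d₁ ⟩ *q ⟨ a₂ , b₂ , c₂ , d₂ ⟩ =
    ⟨ (((a₁ * a₂) + (- (b₁ * b₂))) + (- ((c₁ * c₂) + (d₁ * d₂))))
    , (((a₁ * b₂) + (b₁ * a₂)) + ((c₁ * d₂) + (- (d₁ * c₂))))
    , (((a₁ * c₂) + (- (b₁ * d₂))) + ((c₁ * a₂) + (d₁ * b₂)))
    , (((a₁ * d₂) + (b₁ * c₂)) + ((d₁ * a₂) + (- (c₁ * b₂)))) ⟩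

  -q_ : Quaternion A → Quaternion A
  -q ⟨ a , b , c , d ⟩ = ⟨ - a , - b , - c , - d ⟩

module QuaternionRing {A : Set} {_+_ _*_ : A → A → A} { -_ : A → A} {0# 1# : A}
  (K : IsCommutativeRing _≡_ _+_ _*_ -_ 0# 1#) (_≟_ : DecidableEquality A) where

  open IsCommutativeRing K using (+-assoc; +-comm; +-identityˡ; +-identityʳ; -‿inverseˡ; -‿inverseʳ)
  open QuaternionOps _+_ _*_ -_ public

  almostCommutativeRing : ACR.AlmostCommutativeRing 0ℓ 0ℓ
  almostCommutativeRing = ACR.fromCommutativeRing (record { isCommutativeRing = K })

  open Simple almostCommutativeRing _≟_
    using (Polynomial; var; con; _:+_; _:*_; :-_; ⟦_⟧; ⟦_⟧↓; prove)
  module Formal = QuaternionOps {Polynomial 12} _:+_ _:*_ :-_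

  0q 1q : Quaternion A
  0q = ⟨ 0# , 0# , 0# , 0# ⟩
  1q = ⟨ 1# , 0# , 0# , 0# ⟩

  Expr : Set
  Expr = Quaternion (Polynomial 12)

  X Y Z 1E : Expr
  X = ⟨ var (# 0) , var (# 1) , var (# 2) , var (# 3) ⟩
  Y = ⟨ var (# 4) , var (# 5) , var (# 6) , var (# 7) ⟩
  Z = ⟨ var (# 8) , var (# 9) , var (# 10) , var (# 11) ⟩
  1E = ⟨ con 1# , con 0# , con 0# , con 0# ⟩

  env : (x y z : Quaternion A) → Vec A 12
  env ⟨ a₁ , b₁ , c₁ , d₁ ⟩ ⟨ a₂ , b₂ , c₂ , d₂ ⟩ ⟨ a₃ , b₃ , c₃ , d₃ ⟩ =
    a₁ ∷ b₁ ∷ c₁ ∷ d₁ ∷ a₂ ∷ b₂ ∷ c₂ ∷ d₂ ∷ a₃ ∷ b₃ ∷ c₃ ∷ d₃ ∷ []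

  record SameNormalForm (L R : Expr) : Set where
    constructor normal
    field
      nf₀ : ∀ ρ → ⟦ q₀ L ⟧↓ ρ ≡ ⟦ q₀ R ⟧↓ ρ
      nf₁ : ∀ ρ → ⟦ q₁ L ⟧↓ ρ ≡ ⟦ q₁ R ⟧↓ ρ
      nf₂ : ∀ ρ → ⟦ q₂ L ⟧↓ ρ ≡ ⟦ q₂ R ⟧↓ ρ
      nf₃ : ∀ ρ → ⟦ q₃ L ⟧↓ ρ ≡ ⟦ q₃ R ⟧↓ ρ

  ⟦_⟧q : Expr → Vec A 12 → Quaternion A
  ⟦ L ⟧q ρ = ⟨ ⟦ q₀ L ⟧ ρ , ⟦ q₁ L ⟧ ρ , ⟦ q₂ L ⟧ ρ , ⟦ q₃ L ⟧ ρ ⟩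

  proveq : ∀ L R → SameNormalForm L R → ∀ ρ → ⟦ L ⟧q ρ ≡ ⟦ R ⟧q ρ
  proveq L R (normal e₀ e₁ e₂ e₃) ρ =
    ⟨⟩-cong (prove ρ (q₀ L) (q₀ R) (e₀ ρ)) (prove ρ (q₁ L) (q₁ R) (e₁ ρ))
            (prove ρ (q₂ L) (q₂ R) (e₂ ρ)) (prove ρ (q₃ L) (q₃ R) (e₃ ρ))

  -- The normal forms of the ring solver compute only over a concrete base ring,
  -- where each of these hypotheses holds by refl.
  module _
    (assoc : SameNormalForm ((X Formal.*q Y) Formal.*q Z) (X Formal.*q (Y Formal.*q Z)))
    (identˡ : SameNormalForm (1E Formal.*q X) X)
    (identʳ : SameNormalForm (X Formal.*q 1E) X)
    (distribˡ : SameNormalForm (X Formal.*q (Y Formal.+q Z)) ((X Formal.*q Y) Formal.+q (X Formal.*q Z)))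
    (distribʳ : SameNormalForm ((Y Formal.+q Z) Formal.*q X) ((Y Formal.*q X) Formal.+q (Z Formal.*q X)))
    where

    isRing-q : IsRing _≡_ _+q_ _*q_ -q_ 0q 1q
    isRing-q = record
      { +-isAbelianGroup = record
        { isGroup = record
          { isMonoid = record
            { isSemigroup = record
              { isMagma = record { isEquivalence = ≡.isEquivalence ; ∙-cong = cong₂ _+q_ }
              ; assoc = λ { ⟨ a , b , c , d ⟩ ⟨ a′ , b′ , c′ , d′ ⟩ ⟨ a″ , b″ , c″ , d″ ⟩ →
                  ⟨⟩-cong (+-assoc a a′ a″) (+-assoc b b′ b″) (+-assoc c c′ c″) (+-assoc d d′ d″) }
              }
            ; identity =
                (λ { ⟨ a , b , c , d ⟩ → ⟨⟩-cong (+-identityˡ a) (+-identityˡ b) (+-identityˡ c) (+-identityˡ d) })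
              , (λ { ⟨ a , b , c , d ⟩ → ⟨⟩-cong (+-identityʳ a) (+-identityʳ b) (+-identityʳ c) (+-identityʳ d) })
            }
          ; inverse =
              (λ { ⟨ a , b , c , d ⟩ → ⟨⟩-cong (-‿inverseˡ a) (-‿inverseˡ b) (-‿inverseˡ c) (-‿inverseˡ d) })
            , (λ { ⟨ a , b , c , d ⟩ → ⟨⟩-cong (-‿inverseʳ a) (-‿inverseʳ b) (-‿inverseʳ c) (-‿inverseʳ d) })
          ; ⁻¹-cong = cong -q_
          }
        ; comm = λ { ⟨ a , b , c , d ⟩ ⟨ a′ , b′ , c′ , d′ ⟩ →
            ⟨⟩-cong (+-comm a a′) (+-comm b b′) (+-comm c c′) (+-comm d d′) }
        }
      ; *-cong = cong₂ _*q_
      ; *-assoc = λ x y z → proveq ((X Formal.*q Y) Formal.*q Z) (X Formal.*q (Y Formal.*q Z)) assoc (env x y z)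
      ; *-identity =
          (λ x → proveq (1E Formal.*q X) X identˡ (env x x x))
        , (λ x → proveq (X Formal.*q 1E) X identʳ (env x x x))
      ; distrib =
          (λ x y z → proveq (X Formal.*q (Y Formal.+q Z)) ((X Formal.*q Y) Formal.+q (X Formal.*q Z)) distribˡ (env x y z))
        , (λ x y z → proveq ((Y Formal.+q Z) Formal.*q X) ((Y Formal.*q X) Formal.+q (Z Formal.*q X)) distribʳ (env x y z))
      }

module 𝔽₃-Quaternion = QuaternionRing (CommutativeRing.isCommutativeRing 𝔽₃-commutativeRing) _≟₃_
module ℚ-Quaternion = QuaternionRing ℚ.+-*-isCommutativeRing ℚ._≟_

open 𝔽₃-Quaternion using (_+q_; _*q_; -q_; 0q; 1q)

H₃ : Set
H₃ = Quaternion 𝔽₃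

H₃-isRing : IsRing _≡_ _+q_ _*q_ -q_ 0q 1q
H₃-isRing = isRing-q
  (normal (λ _ → refl) (λ _ → refl) (λ _ → refl) (λ _ → refl))
  (normal (λ _ → refl) (λ _ → refl) (λ _ → refl) (λ _ → refl))
  (normal (λ _ → refl) (λ _ → refl) (λ _ → refl) (λ _ → refl))
  (normal (λ _ → refl) (λ _ → refl) (λ _ → refl) (λ _ → refl))
  (normal (λ _ → refl) (λ _ → refl) (λ _ → refl) (λ _ → refl))
  where open 𝔽₃-Quaternion using (isRing-q; normal)

ℚ-Quaternion-isRing : IsRing _≡_ ℚ-Quaternion._+q_ ℚ-Quaternion._*q_ ℚ-Quaternion.-q_ ℚ-Quaternion.0q ℚ-Quaternion.1q
ℚ-Quaternion-isRing = isRing-q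
  (normal (λ _ → refl) (λ _ → refl) (λ _ → refl) (λ _ → refl))
  (normal (λ _ → refl) (λ _ → refl) (λ _ → refl) (λ _ → refl))
  (normal (λ _ → refl) (λ _ → refl) (λ _ → refl) (λ _ → refl))
  (normal (λ _ → refl) (λ _ → refl) (λ _ → refl) (λ _ → refl))
  (normal (λ _ → refl) (λ _ → refl) (λ _ → refl) (λ _ → refl))
  where open ℚ-Quaternion

ℍ-isRing : IsRing _≡_ _+ℍ_ _*ℍ_ -ℍ_ 0ℍ 1ℍ
ℍ-isRing = RingMonomorphism.isRing
  (record
    { isRingHomomorphism = record
      { isSemiringHomomorphism = record
        { isNearSemiringHomomorphism = record
          { +-isMonoidHomomorphism = record
            { isMagmaHomomorphism = record
              { isRelHomomorphism = record { cong = cong toQ } ; homo = λ _ _ → refl }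
            ; ε-homo = refl }
          ; *-homo = λ _ _ → refl }
        ; 1#-homo = refl }
      ; -‿homo = λ _ → refl }
    ; injective = cong fromQ })
  ℚ-Quaternion-isRing
  where
  toQ : ℍ → Quaternion ℚ
  toQ (quat a b c d) = ⟨ a , b , c , d ⟩
  fromQ : Quaternion ℚ → ℍ
  fromQ ⟨ a , b , c , d ⟩ = quat a b c d

-- The Dowling geometry of the quaternion group

-- The elements 1, -1, i, -i, j, -j, k, -k of the quaternion group, in this order.
Q₈ : Set
Q₈ = Fin 8

pattern 1₈ = zero
pattern -1₈ = suc zero

infixl 7 _·_

_·_ : Q₈ → Q₈ → Q₈
m · n = lookup (lookup table m) n
  where
  table : Vec (Vec Q₈ 8) 8
  table =
      (# 0 ∷ # 1 ∷ # 2 ∷ # 3 ∷ # 4 ∷ # 5 ∷ # 6 ∷ # 7 ∷ [])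
    ∷ (# 1 ∷ # 0 ∷ # 3 ∷ # 2 ∷ # 5 ∷ # 4 ∷ # 7 ∷ # 6 ∷ [])
    ∷ (# 2 ∷ # 3 ∷ # 1 ∷ # 0 ∷ # 6 ∷ # 7 ∷ # 5 ∷ # 4 ∷ [])
    ∷ (# 3 ∷ # 2 ∷ # 0 ∷ # 1 ∷ # 7 ∷ # 6 ∷ # 4 ∷ # 5 ∷ [])
    ∷ (# 4 ∷ # 5 ∷ # 7 ∷ # 6 ∷ # 1 ∷ # 0 ∷ # 2 ∷ # 3 ∷ [])
    ∷ (# 5 ∷ # 4 ∷ # 6 ∷ # 7 ∷ # 0 ∷ # 1 ∷ # 3 ∷ # 2 ∷ [])
    ∷ (# 6 ∷ # 7 ∷ # 4 ∷ # 5 ∷ # 3 ∷ # 2 ∷ # 1 ∷ # 0 ∷ [])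
    ∷ (# 7 ∷ # 6 ∷ # 5 ∷ # 4 ∷ # 2 ∷ # 3 ∷ # 0 ∷ # 1 ∷ [])
    ∷ []

_⁻¹₈ : Q₈ → Q₈
m ⁻¹₈ = lookup (# 0 ∷ # 1 ∷ # 3 ∷ # 2 ∷ # 5 ∷ # 4 ∷ # 7 ∷ # 6 ∷ []) m

·-identityˡ : ∀ m → 1₈ · m ≡ m
·-identityˡ = from-yes (Fin.all? λ m → (1₈ · m) Fin.≟ m)

·-identityʳ : ∀ m → m · 1₈ ≡ m
·-identityʳ = from-yes (Fin.all? λ m → (m · 1₈) Fin.≟ m)

·-inverseʳ : ∀ m → m · (m ⁻¹₈) ≡ 1₈
·-inverseʳ = from-yes (Fin.all? λ m → (m · (m ⁻¹₈)) Fin.≟ 1₈)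

·-cancel : ∀ m n → m · (n ⁻¹₈) ≡ 1₈ → m ≡ n
·-cancel = from-yes (Fin.all? λ m → Fin.all? λ n → ((m · (n ⁻¹₈)) Fin.≟ 1₈) →-dec (m Fin.≟ n))

-- The property of the quaternion group that replaces cancellation in rings with zero divisors; see
-- `fixed⇒one`.
power-is-minus-one : ∀ m → m ≡ 1₈ ⊎ m ≡ -1₈ ⊎ m · m ≡ -1₈
power-is-minus-one = from-yes (Fin.all? λ m → (m Fin.≟ 1₈) ⊎-dec ((m Fin.≟ -1₈) ⊎-dec ((m · m) Fin.≟ -1₈)))

-- The common ground of ℍ and H₃. The latter has zero divisors, so the absence of 2-torsion is
-- assumed instead of invertibility.
record Q₈-Ring : Set₁ where
  infixl 6 _+_
  infixl 7 _*_
  infix 8 -_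
  field
    A : Set
    _+_ _*_ : A → A → A
    -_ : A → A
    0# 1# : A
    isRing : IsRing _≡_ _+_ _*_ -_ 0# 1#
    _≟_ : DecidableEquality A
    1≢0 : 1# ≢ 0#
    2-torsion-free : ∀ x → x + x ≡ 0# → x ≡ 0#
    q : Q₈ → A
    q-one : q 1₈ ≡ 1#
    q-minus-one : q -1₈ ≡ - 1#
    q-mul : ∀ m n → q m * q n ≡ q (m · n)

  ring : Ring 0ℓ 0ℓ
  ring = record { isRing = isRing }

  open IsRing isRing public using
    (+-assoc; +-comm; +-identityˡ; +-identityʳ; -‿inverseˡ; -‿inverseʳ; *-assoc; *-identityˡ; *-identityʳ; distribˡ; distribʳ; zeroˡ; zeroʳ)
  open RingProperties ring public using (-‿distribʳ-*; -‿+-comm; +-inverseˡ-unique; -‿involutive)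

-- The cyclic numbering makes the three sides of the geometry uniform: a, b, c are
-- on 0, on 1, on 2 below, and a row vector y takes the value - y t + y (t + 1) q m on
-- the column of on t m.
σ : Fin 3 → Fin 3
σ zero = # 1
σ (suc zero) = # 2
σ (suc (suc zero)) = # 0

σ³ : ∀ t → σ (σ (σ t)) ≡ t
σ³ = from-yes (Fin.all? λ t → σ (σ (σ t)) Fin.≟ t)

data Point : Set where
  joint : Fin 3 → Point
  on : Fin 3 → Q₈ → Point

point : Fin 27 → Point
point = [ joint , [ on (# 0) , [ on (# 1) , on (# 2) ]′ ∘ splitAt 8 ]′ ∘ splitAt 8 ]′ ∘ splitAt 3

index : Point → Fin 27
index (joint t) = t ↑ˡ 24
index (on zero m) = 3 ↑ʳ (m ↑ˡ 16)
index (on (suc zero) m) = 3 ↑ʳ (8 ↑ʳ (m ↑ˡ 8))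
index (on (suc (suc zero)) m) = 3 ↑ʳ (8 ↑ʳ (8 ↑ʳ m))

point-index : ∀ p → point (index p) ≡ p
point-index (joint t) rewrite Fin.splitAt-↑ˡ 3 t 24 = refl
point-index (on zero m) rewrite Fin.splitAt-↑ˡ 8 m 16 = refl
point-index (on (suc zero) m) rewrite Fin.splitAt-↑ˡ 8 m 8 = refl
point-index (on (suc (suc zero)) m) = refl

-- Case analysis relative to an arbitrary starting side, so that arguments are made once up to
-- rotation.
cyclic : ∀ {p} (P : Fin 3 → Set p) t → P t → P (σ t) → P (σ (σ t)) → ∀ u → P u
cyclic P zero a b c zero = a
cyclic P zero a b c (suc zero) = b
cyclic P zero a b c (suc (suc zero)) = c
cyclic P (suc zero) a b c zero = c
cyclic P (suc zero) a b c (suc zero) = a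
cyclic P (suc zero) a b c (suc (suc zero)) = b
cyclic P (suc (suc zero)) a b c zero = b
cyclic P (suc (suc zero)) a b c (suc zero) = c
cyclic P (suc (suc zero)) a b c (suc (suc zero)) = a

-- Row vectors with entries in Q₈ ∪ {0}; nothing stands for 0.
Symbolic : Set
Symbolic = Fin 3 → Maybe Q₈

_·?_ : Maybe Q₈ → Q₈ → Maybe Q₈
nothing ·? m = nothing
just n ·? m = just (n · m)

-- The vanishing of - y t + y (t + 1) q m, read in Q₈ ∪ {0}. No ring is involved, which is why the
-- supports are the same over ℍ and over H₃.
Zero : Symbolic → Point → Set
Zero s (joint t) = s t ≡ nothing
Zero s (on t m) = s t ≡ s (σ t) ·? m

zero? : ∀ s p → Dec (Zero s p)
zero? s (joint t) = Maybe.≡-dec Fin._≟_ (s t) nothing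
zero? s (on t m) = Maybe.≡-dec Fin._≟_ (s t) (s (σ t) ·? m)

-- side t is the line through the two joints other than t, cevian t m joins the third
-- joint t + 2 to the point on t m, and transversals contain no joint.
data Line : Set where
  side : Fin 3 → Line
  cevian : Fin 3 → Q₈ → Line
  transversal : Fin 3 → Q₈ → Q₈ → Line

rotate : {A : Set} → Fin 3 → A → A → A → Fin 3 → A
rotate t x y z = cyclic _ t x y z

rotate₀ : ∀ {A : Set} t {x y z : A} → rotate t x y z t ≡ x
rotate₀ zero = refl
rotate₀ (suc zero) = refl
rotate₀ (suc (suc zero)) = refl

rotate₁ : ∀ {A : Set} t {x y z : A} → rotate t x y z (σ t) ≡ y
rotate₁ zero = refl
rotate₁ (suc zero) = refl
rotate₁ (suc (suc zero)) = refl

rotate₂ : ∀ {A : Set} t {x y z : A} → rotate t x y z (σ (σ t)) ≡ z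
rotate₂ zero = refl
rotate₂ (suc zero) = refl
rotate₂ (suc (suc zero)) = refl

zero-on : ∀ s t {m x y} → s t ≡ just x → s (σ t) ≡ just y → x ≡ y · m → Zero s (on t m)
zero-on s t {m} sx sy xy = trans sx (trans (cong just xy) (sym (cong (_·? m) sy)))

-- The entries make `on t m` a zero of a cevian, and `on t m` and `on (σ t) n` zeros of a
-- transversal. The third point of the transversal is then `on (σ (σ t)) ((n · m) ⁻¹₈)`.
covector : Line → Symbolic
covector (side t) = rotate t (just 1₈) nothing nothing
covector (cevian t m) = rotate t (just m) (just 1₈) nothing
covector (transversal t m n) = rotate t (just (n · m)) (just n) (just 1₈)

covector-nonzero : ∀ l → ∃ λ t → covector l t ≢ nothing
covector-nonzero l = first l , λ eq → contradiction (trans (sym (proj₂ (entry l))) eq) λ ()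
  where
  first : Line → Fin 3
  first (side t) = t
  first (cevian t m) = t
  first (transversal t m n) = t
  entry : ∀ l → ∃ λ m → covector l (first l) ≡ just m
  entry (side t) = 1₈ , rotate₀ t
  entry (cevian t m) = m , rotate₀ t
  entry (transversal t m n) = n · m , rotate₀ t

-- Cocircuits are the complements of hyperplanes, which are lines in rank 3.
Avoids : Line → Subset 27 → Set
Avoids l X = ∀ i → (i ∈ X) ⇔ (¬ Zero (covector l) (point i))

module Dowling (𝓡 : Q₈-Ring) where
  open Q₈-Ring 𝓡

  value : (Fin 3 → A) → Point → A
  value y (joint t) = y t
  value y (on t m) = (- y t) + y (σ t) * q m

  value-+ : ∀ x y p → value (λ t → x t + y t) p ≡ value x p + value y p
  value-+ x y (joint t) = refl
  value-+ x y (on t m) = begin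
    (- (x t + y t)) + (x (σ t) + y (σ t)) * q m          ≡⟨ cong₂ _+_ (sym (-‿+-comm (x t) (y t))) (distribʳ (q m) (x (σ t)) (y (σ t))) ⟩
    ((- x t) + (- y t)) + (x (σ t) * q m + y (σ t) * q m) ≡⟨ interchange (- x t) (- y t) (x (σ t) * q m) (y (σ t) * q m) ⟩
    ((- x t) + x (σ t) * q m) + ((- y t) + y (σ t) * q m) ∎
    where
    open ≡-Reasoning
    open CommutativeSemigroupProperties (CommutativeMonoid.commutativeSemigroup (Ring.+-commutativeMonoid ring)) using (interchange)

  value-* : ∀ r y p → value (λ t → r * y t) p ≡ r * value y p
  value-* r y (joint t) = refl
  value-* r y (on t m) = begin
    (- (r * y t)) + r * y (σ t) * q m   ≡⟨ cong₂ _+_ (-‿distribʳ-* r (y t)) (*-assoc r (y (σ t)) (q m)) ⟩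
    r * (- y t) + r * (y (σ t) * q m)   ≡⟨ distribˡ r (- y t) (y (σ t) * q m) ⟨
    r * ((- y t) + y (σ t) * q m)       ∎
    where open ≡-Reasoning

  value-cong : ∀ {x y} → (∀ t → x t ≡ y t) → ∀ p → value x p ≡ value y p
  value-cong eq (joint t) = eq t
  value-cong eq (on t m) = cong₂ (λ a b → (- a) + b * q m) (eq t) (eq (σ t))

  -x+y≡0⇒x≡y : ∀ {x y} → (- x) + y ≡ 0# → x ≡ y
  -x+y≡0⇒x≡y {x} {y} eq = trans (sym (-‿involutive x)) (trans (cong -_ (+-inverseˡ-unique (- x) y eq)) (-‿involutive y))

  vanishes-on : ∀ {y t m} → y t ≡ y (σ t) * q m → value y (on t m) ≡ 0#
  vanishes-on {y} {t} {m} eq = trans (cong ((- y t) +_) (sym eq)) (-‿inverseˡ (y t))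

  self-opposite : ∀ {x} → x ≡ x * (- 1#) → x ≡ 0#
  self-opposite {x} eq = 2-torsion-free x (trans (cong (x +_) (trans eq (trans (sym (-‿distribʳ-* x 1#)) (cong -_ (*-identityʳ x))))) (-‿inverseʳ x))

  -- The scalar `r` may be a zero divisor. Powers of `m` fix it as well, and unless `m` is 1 one of
  -- them is -1, so that r = -r and `r` would be 2-torsion.
  fixed⇒one : ∀ {r m} → r ≢ 0# → r ≡ r * q m → m ≡ 1₈
  fixed⇒one {r} {m} r≢0 eq with power-is-minus-one m
  ... | inj₁ m≡1 = m≡1
  ... | inj₂ (inj₁ refl) = ⊥-elim (r≢0 (self-opposite (trans eq (cong (r *_) q-minus-one))))
  ... | inj₂ (inj₂ m²≡-1) = ⊥-elim (r≢0 (self-opposite (begin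
    r               ≡⟨ eq ⟩
    r * q m         ≡⟨ cong (_* q m) eq ⟩
    r * q m * q m   ≡⟨ *-assoc r (q m) (q m) ⟩
    r * (q m * q m) ≡⟨ cong (r *_) (q-mul m m) ⟩
    r * q (m · m)   ≡⟨ cong (λ n → r * q n) m²≡-1 ⟩
    r * q -1₈       ≡⟨ cong (r *_) q-minus-one ⟩
    r * (- 1#)      ∎)))
    where open ≡-Reasoning

  *q*q : ∀ r m n → r * q m * q n ≡ r * q (m · n)
  *q*q r m n = trans (*-assoc r (q m) (q n)) (cong (r *_) (q-mul m n))

  *q-one : ∀ r → r * q 1₈ ≡ r
  *q-one r = trans (cong (r *_) q-one) (*-identityʳ r)

  *q-inverse : ∀ r m → r * q m * q (m ⁻¹₈) ≡ r
  *q-inverse r m = trans (*q*q r m (m ⁻¹₈)) (trans (cong (λ n → r * q n) (·-inverseʳ m)) (*q-one r))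

  *q-nonzero : ∀ {r m} → r ≢ 0# → r * q m ≢ 0#
  *q-nonzero {r} {m} r≢0 eq = r≢0 (begin
    r                    ≡⟨ *q-inverse r m ⟨
    r * q m * q (m ⁻¹₈)  ≡⟨ cong (_* q (m ⁻¹₈)) eq ⟩
    0# * q (m ⁻¹₈)       ≡⟨ zeroˡ _ ⟩
    0#                   ∎)
    where open ≡-Reasoning

  *q-injective : ∀ {r m n} → r ≢ 0# → r * q m ≡ r * q n → m ≡ n
  *q-injective {r} {m} {n} r≢0 eq = ·-cancel m n (fixed⇒one r≢0 (begin
    r                     ≡⟨ *q-inverse r n ⟨
    r * q n * q (n ⁻¹₈)   ≡⟨ cong (_* q (n ⁻¹₈)) eq ⟨
    r * q m * q (n ⁻¹₈)   ≡⟨ *q*q r m (n ⁻¹₈) ⟩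
    r * q (m · (n ⁻¹₈))   ∎))
    where open ≡-Reasoning

  q? : Maybe Q₈ → A
  q? nothing = 0#
  q? (just m) = q m

  *q?-injective : ∀ {r} a b → r ≢ 0# → r * q? a ≡ r * q? b → a ≡ b
  *q?-injective nothing nothing r≢0 eq = refl
  *q?-injective nothing (just n) r≢0 eq = ⊥-elim (*q-nonzero r≢0 (trans (sym eq) (zeroʳ _)))
  *q?-injective (just m) nothing r≢0 eq = ⊥-elim (*q-nonzero r≢0 (trans eq (zeroʳ _)))
  *q?-injective (just m) (just n) r≢0 eq = cong just (*q-injective r≢0 eq)

  *q?*q : ∀ r a m → r * q? a * q m ≡ r * q? (a ·? m)
  *q?*q r nothing m = trans (cong (_* q m) (zeroʳ r)) (trans (zeroˡ _) (sym (zeroʳ r)))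
  *q?*q r (just n) m = *q*q r n m

  scale : A → Symbolic → Fin 3 → A
  scale r s t = r * q? (s t)

  scale-zero : ∀ r s p → Zero s p → value (scale r s) p ≡ 0#
  scale-zero r s (joint t) z = trans (cong (λ a → r * q? a) z) (zeroʳ r)
  scale-zero r s (on t m) z = vanishes-on {scale r s} {t} {m} (trans (cong (λ a → r * q? a) z) (sym (*q?*q r (s (σ t)) m)))

  zero-scale : ∀ {r} s p → r ≢ 0# → value (scale r s) p ≡ 0# → Zero s p
  zero-scale {r} s (joint t) r≢0 eq = *q?-injective (s t) nothing r≢0 (trans eq (sym (zeroʳ r)))
  zero-scale {r} s (on t m) r≢0 eq =
    *q?-injective (s t) (s (σ t) ·? m) r≢0 (trans (-x+y≡0⇒x≡y eq) (*q?*q r (s (σ t)) m))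

  rotate-scale : ∀ {r} t {x y z} (w : Fin 3 → A) → w t ≡ r * q? x → w (σ t) ≡ r * q? y → w (σ (σ t)) ≡ r * q? z →
                 ∀ u → w u ≡ scale r (rotate t x y z) u
  rotate-scale {r} t w wx wy wz = cyclic _ t
    (trans wx (cong (λ a → r * q? a) (sym (rotate₀ t))))
    (trans wy (cong (λ a → r * q? a) (sym (rotate₁ t))))
    (trans wz (cong (λ a → r * q? a) (sym (rotate₂ t))))

  -- The factor is the entry of `y` at the place where the last nonzero entry of the covector is 1;
  -- the zeros on the line then determine the other two entries.
  vanishes⇒scale : ∀ l y → (∀ p → Zero (covector l) p → value y p ≡ 0#) →
                   ∃ λ r → ∀ u → y u ≡ scale r (covector l) u
  vanishes⇒scale (side t) y h = y t , rotate-scale t y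
    (sym (*q-one (y t)))
    (trans (h (joint (σ t)) (rotate₁ t)) (sym (zeroʳ _)))
    (trans (h (joint (σ (σ t))) (rotate₂ t)) (sym (zeroʳ _)))
  vanishes⇒scale (cevian t m) y h = y (σ t) , rotate-scale t y
    (-x+y≡0⇒x≡y (h (on t m) (zero-on (covector (cevian t m)) t (rotate₀ t) (rotate₁ t) (sym (·-identityˡ m)))))
    (sym (*q-one (y (σ t))))
    (trans (h (joint (σ (σ t))) (rotate₂ t)) (sym (zeroʳ _)))
  vanishes⇒scale (transversal t m n) y h = y (σ (σ t)) , rotate-scale t y
    (trans (-x+y≡0⇒x≡y (h (on t m) (zero-on (covector (transversal t m n)) t (rotate₀ t) (rotate₁ t) refl)))
           (trans (cong (_* q m) σt) (*q*q _ n m)))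
    σt
    (sym (*q-one _))
    where
    σt : y (σ t) ≡ y (σ (σ t)) * q n
    σt = -x+y≡0⇒x≡y (h (on (σ t) n) (zero-on (covector (transversal t m n)) (σ t) (rotate₁ t) (rotate₂ t) (sym (·-identityˡ n))))

  Matched : (Fin 3 → A) → Fin 3 → Set
  Matched y t = ∃ λ m → y t ≡ y (σ t) * q m

  matched? : ∀ y t → Dec (Matched y t)
  matched? y t = Fin.any? λ m → y t ≟ (y (σ t) * q m)

  NonZeroVector : (Fin 3 → A) → Set
  NonZeroVector y = ∃ λ t → y t ≢ 0#

  scale⇒zeros : ∀ {r} s {y} → NonZeroVector y → (∀ u → y u ≡ scale r s u) → ∀ p → value y p ≡ 0# → Zero s p
  scale⇒zeros {r} s {y} (t , yt≢0) eq p vp = zero-scale s p r≢0 (trans (sym (value-cong eq p)) vp)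
    where
    r≢0 : r ≢ 0#
    r≢0 refl = yt≢0 (trans (eq t) (zeroˡ _))

  covered-with-zero : ∀ y → NonZeroVector y → ∀ t → y t ≡ 0# → ∃ λ l → ∀ p → value y p ≡ 0# → Zero (covector l) p
  covered-with-zero y nz t yt with y (σ t) ≟ 0# | y (σ (σ t)) ≟ 0# | matched? y (σ t)
  ... | yes y₁ | _ | _ = side (σ (σ t)) , scale⇒zeros _ nz (rotate-scale (σ (σ t)) y
    (sym (*q-one _))
    (trans (cong y (σ³ t)) (trans yt (sym (zeroʳ _))))
    (trans (cong y (cong σ (σ³ t))) (trans y₁ (sym (zeroʳ _)))))
  ... | no _ | yes y₂ | _ = side (σ t) , scale⇒zeros _ nz (rotate-scale (σ t) y
    (sym (*q-one _))
    (trans y₂ (sym (zeroʳ _)))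
    (trans (cong y (σ³ t)) (trans yt (sym (zeroʳ _)))))
  ... | no _ | no _ | yes (m , eq) = cevian (σ t) m , scale⇒zeros _ nz (rotate-scale (σ t) y
    eq
    (sym (*q-one _))
    (trans (cong y (σ³ t)) (trans yt (sym (zeroʳ _)))))
  -- Here `joint t` is the only zero of `y`, so any line through it will do.
  ... | no y₁≢0 | no y₂≢0 | no unmatched = side (σ t) , zeros
    where
    zero-e : ∀ u → y u ≡ 0# → Zero (covector (side (σ t))) (joint u)
    zero-e = cyclic _ t
      (λ _ → trans (cong (covector (side (σ t))) (sym (σ³ t))) (rotate₂ (σ t)))
      (λ y₁ → ⊥-elim (y₁≢0 y₁))
      (λ y₂ → ⊥-elim (y₂≢0 y₂))
    no-d : ∀ u → ¬ Matched y u
    no-d = cyclic _ t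
      (λ { (m , eq) → *q-nonzero y₁≢0 (trans (sym eq) yt) })
      unmatched
      (λ { (m , eq) → y₂≢0 (trans eq (trans (cong (_* q m) (trans (cong y (σ³ t)) yt)) (zeroˡ _))) })
    zeros : ∀ p → value y p ≡ 0# → Zero (covector (side (σ t))) p
    zeros (joint u) = zero-e u
    zeros (on u m) eq = ⊥-elim (no-d u (m , -x+y≡0⇒x≡y eq))

  -- The number of matched sides decides. With none, `y` has no zeros and any line serves. With two,
  -- `y` is a multiple of the covector of a transversal. With exactly one, `*q-injective` shows that
  -- `y` has a single zero, and the cevian through it suffices.
  covered-without-zero : ∀ y → (∀ t → y t ≢ 0#) → ∃ λ l → ∀ p → value y p ≡ 0# → Zero (covector l) p
  covered-without-zero y y≢0 with Fin.any? (matched? y)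
  ... | no none = side (# 0) , λ
    { (joint t) eq → ⊥-elim (y≢0 t eq)
    ; (on t m) eq → ⊥-elim (none (t , m , -x+y≡0⇒x≡y eq)) }
  ... | yes (t , m , eq) with matched? y (σ t) | matched? y (σ (σ t))
  ... | yes (n , eq′) | _ = transversal t m n , scale⇒zeros _ (t , y≢0 t) (rotate-scale t y
    (trans eq (trans (cong (_* q m) eq′) (*q*q _ n m))) eq′ (sym (*q-one _)))
  ... | no _ | yes (n , eq′) = transversal (σ (σ t)) n m , scale⇒zeros _ (t , y≢0 t) (rotate-scale (σ (σ t)) y
    (trans eq′ (trans (cong (_* q n) eqσ) (*q*q _ m n))) eqσ (sym (*q-one _)))
    where
    eqσ : y (σ (σ (σ t))) ≡ y (σ (σ (σ (σ t)))) * q m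
    eqσ = trans (cong y (σ³ t)) (trans eq (cong (λ u → y u * q m) (cong σ (sym (σ³ t)))))
  ... | no un₁ | no un₂ = cevian t m , λ
    { (joint u) eq → ⊥-elim (y≢0 u eq)
    ; (on u n) eq → zero-d n u (-x+y≡0⇒x≡y eq) }
    where
    zero-d : ∀ n u → y u ≡ y (σ u) * q n → Zero (covector (cevian t m)) (on u n)
    zero-d n = cyclic _ t
      (λ eq′ → zero-on (covector (cevian t m)) t (rotate₀ t) (rotate₁ t)
        (trans (*q-injective (y≢0 (σ t)) (trans (sym eq) eq′)) (sym (·-identityˡ n))))
      (λ eq′ → ⊥-elim (un₁ (n , eq′)))
      (λ eq′ → ⊥-elim (un₂ (n , eq′)))

  -- Small supports are large zero sets, so this bounds the supports from below: no nonzero chain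
  -- has a support smaller than the complement of some line.
  covered : ∀ y → NonZeroVector y → ∃ λ l → ∀ p → value y p ≡ 0# → Zero (covector l) p
  covered y nz with Fin.any? (λ t → y t ≟ 0#)
  ... | yes (t , yt) = covered-with-zero y nz t yt
  ... | no none = covered-without-zero y (λ t yt → none (t , yt))

  *-minus-one : ∀ x → x * (- 1#) ≡ - x
  *-minus-one x = trans (sym (-‿distribʳ-* x 1#)) (cong -_ (*-identityʳ x))

  sum₃ : ∀ {a b c x y z} → a ≡ x → b ≡ y → c ≡ z → a + (b + (c + 0#)) ≡ x + y + z
  sum₃ {a} {b} {c} refl refl refl = trans (cong (λ u → a + (b + u)) (+-identityʳ c)) (sym (+-assoc a b c))

  module _ (x y z : A) where

    row-joint₀ : x * 1# + (y * 0# + (z * 0# + 0#)) ≡ x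
    row-joint₀ = trans (sum₃ (*-identityʳ x) (zeroʳ y) (zeroʳ z)) (trans (+-identityʳ _) (+-identityʳ _))

    row-joint₁ : x * 0# + (y * 1# + (z * 0# + 0#)) ≡ y
    row-joint₁ = trans (sum₃ (zeroʳ x) (*-identityʳ y) (zeroʳ z)) (trans (+-identityʳ _) (+-identityˡ _))

    row-joint₂ : x * 0# + (y * 0# + (z * 1# + 0#)) ≡ z
    row-joint₂ = trans (sum₃ (zeroʳ x) (zeroʳ y) (*-identityʳ z)) (trans (cong (_+ z) (+-identityˡ 0#)) (+-identityˡ _))

    row-on₀ : ∀ g → x * (- 1#) + (y * g + (z * 0# + 0#)) ≡ - x + y * g
    row-on₀ g = trans (sum₃ (*-minus-one x) refl (zeroʳ z)) (+-identityʳ _)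

    row-on₁ : ∀ g → x * 0# + (y * (- 1#) + (z * g + 0#)) ≡ - y + z * g
    row-on₁ g = trans (sum₃ (zeroʳ x) (*-minus-one y) refl) (cong (_+ z * g) (+-identityˡ _))

    row-on₂ : ∀ g → x * g + (y * 0# + (z * (- 1#) + 0#)) ≡ - z + x * g
    row-on₂ g = trans (sum₃ refl (zeroʳ y) (*-minus-one z)) (trans (cong (_+ - z) (+-identityʳ _)) (+-comm _ _))

  open Chains {A = A} _≡_ 0#

  DowlingChain : Chain 27 → Set
  DowlingChain x = ∃ λ y → ∀ i → x i ≡ value y (point i)

  evaluate : Line → Chain 27
  evaluate l i = value (scale 1# (covector l)) (point i)

  evaluate-zero : ∀ l i → Zero (covector l) (point i) ⇔ (evaluate l i ≡ 0#)
  evaluate-zero l i = mk⇔ (scale-zero 1# (covector l) (point i)) (zero-scale (covector l) (point i) 1≢0)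

  value-nonzero : ∀ y p → value y p ≢ 0# → NonZeroVector y
  value-nonzero y p v≢0 with Fin.any? (λ t → ¬? (y t ≟ 0#))
  ... | yes nz = nz
  ... | no none = ⊥-elim (v≢0 (trans (value-cong {y} {λ _ → 0# * 0#} y≡0 p) (trans (value-* 0# (λ _ → 0#) p) (zeroˡ _))))
    where
    y≡0 : ∀ t → y t ≡ 0# * 0#
    y≡0 t = trans (decidable-stable (y t ≟ 0#) (λ yt → none (t , yt))) (sym (zeroˡ 0#))

  point-value : ∀ y p → value y (point (index p)) ≡ value y p
  point-value y p = cong (value y) (point-index p)

  evaluate-nonzero : ∀ l → NonZeroChain (evaluate l)
  evaluate-nonzero l = index (joint (proj₁ (covector-nonzero l))) , λ eq →
    proj₂ (covector-nonzero l) (subst (Zero (covector l)) (point-index (joint (proj₁ (covector-nonzero l)))) (Equivalence.from (evaluate-zero l (index (joint (proj₁ (covector-nonzero l))))) eq))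

  -- A chain that vanishes on the line is a left multiple of the covector by `vanishes⇒scale`, and
  -- by `scale⇒zeros` a nonzero multiple has no further zeros, even if the factor is a zero divisor.
  evaluate-elementary : ∀ l → Elementary DowlingChain (evaluate l)
  evaluate-elementary l = (scale 1# (covector l) , λ i → refl) , evaluate-nonzero l , minimal
    where
    minimal : ∀ x → DowlingChain x → ¬ (NonZeroChain x × StrictSubsupport x (evaluate l))
    minimal x (y , x≡) ((i , xi≢0) , sub , j , evj≢0 , ¬xj) =
      let r , y≡ = vanishes⇒scale l y (λ p z → trans (sym (point-value y p)) (trans (sym (x≡ (index p)))
            (decidable-stable (x (index p) ≟ 0#) λ x≢0 → sub (index p) x≢0
              (Equivalence.to (evaluate-zero l (index p)) (subst (Zero (covector l)) (sym (point-index p)) z)))))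
      in evj≢0 (Equivalence.to (evaluate-zero l j)
           (scale⇒zeros (covector l) (value-nonzero y (point i) (λ eq → xi≢0 (trans (x≡ i) eq))) y≡ (point j)
             (trans (sym (x≡ j)) (decidable-stable (x j ≟ 0#) ¬xj))))

  elementary⇒multiple : ∀ x → Elementary DowlingChain x →
    ∃ λ l → (∀ i → (¬ Zero (covector l) (point i)) ⇔ supp x i) × (∃ λ r → ∀ i → x i ≡ r * evaluate l i)
  elementary⇒multiple x ((y , x≡) , (i , xi≢0) , minimal) =
    l , (λ j → mk⇔ (λ nz xj → nz (zeros (point j) (trans (sym (x≡ j)) xj)))
                   (λ xj≢0 z → xj≢0 (trans (x≡ j) (vanish (point j) z)))) ,
    r , λ j → trans (x≡ j) (trans (value-cong y≡r1 (point j)) (value-* r (scale 1# (covector l)) (point j)))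
    where
    cov = covered y (value-nonzero y (point i) (λ eq → xi≢0 (trans (x≡ i) eq)))
    l = proj₁ cov
    zeros = proj₂ cov
    vanish : ∀ p → Zero (covector l) p → value y p ≡ 0#
    vanish p z with value y p ≟ 0#
    ... | yes eq = eq
    -- All zeros of `x` lie on `l`. Were `x` nonzero somewhere on `l`, the support of `evaluate l`
    -- would be strictly smaller.
    ... | no v≢0 = ⊥-elim (minimal (evaluate l) (scale 1# (covector l) , λ j → refl) (evaluate-nonzero l ,
      (λ j ev≢0 xj → ev≢0 (Equivalence.to (evaluate-zero l j) (zeros (point j) (trans (sym (x≡ j)) xj)))) ,
      index p , (λ xp → v≢0 (trans (sym (point-value y p)) (trans (sym (x≡ (index p))) xp))) ,
      λ ev≢0 → ev≢0 (Equivalence.to (evaluate-zero l (index p)) (subst (Zero (covector l)) (sym (point-index p)) z))))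
    mult = vanishes⇒scale l y vanish
    r = proj₁ mult
    y≡r1 : ∀ t → y t ≡ r * (1# * q? (covector l t))
    y≡r1 t = trans (proj₂ mult t) (cong (r *_) (sym (*-identityˡ _)))

  -- The right-hand side does not mention the ring, so it transfers the matroid from ℍ to H₃.
  cocircuit⇔ : ∀ X → IsCocircuitOf DowlingChain X ⇔ ∃ λ l → Avoids l X
  cocircuit⇔ X = mk⇔
    (λ { (x , el , X⇔) → let l , l⇔ , _ = elementary⇒multiple x el in
      l , λ i → mk⇔ (λ i∈X → Equivalence.from (l⇔ i) (Equivalence.to (X⇔ i) i∈X))
                    (λ nz → Equivalence.from (X⇔ i) (Equivalence.to (l⇔ i) nz)) })
    (λ { (l , X⇔) → evaluate l , evaluate-elementary l ,
      λ i → mk⇔ (λ i∈X ev → Equivalence.to (X⇔ i) i∈X (Equivalence.from (evaluate-zero l i) ev))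
                (λ ev≢0 → Equivalence.from (X⇔ i) (λ z → ev≢0 (Equivalence.to (evaluate-zero l i) z))) })

-- Direct sums of chain groups

∈-++ˡ : ∀ {m n} (Y : Subset m) (Z : Subset n) i → (i ↑ˡ n ∈ Y ++ Z) ⇔ (i ∈ Y)
∈-++ˡ Y Z i = mk⇔
  (λ i∈ → Vec.lookup⇒[]= i Y (trans (sym (Vec.lookup-++ˡ Y Z i)) (Vec.[]=⇒lookup i∈)))
  (λ i∈ → Vec.lookup⇒[]= _ (Y ++ Z) (trans (Vec.lookup-++ˡ Y Z i) (Vec.[]=⇒lookup i∈)))

∈-++ʳ : ∀ {m n} (Y : Subset m) (Z : Subset n) j → (m ↑ʳ j ∈ Y ++ Z) ⇔ (j ∈ Z)
∈-++ʳ Y Z j = mk⇔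
  (λ j∈ → Vec.lookup⇒[]= j Z (trans (sym (Vec.lookup-++ʳ Y Z j)) (Vec.[]=⇒lookup j∈)))
  (λ j∈ → Vec.lookup⇒[]= _ (Y ++ Z) (trans (Vec.lookup-++ʳ Y Z j) (Vec.[]=⇒lookup j∈)))

split-elim : ∀ {p} m {n} (P : Fin (m +ℕ n) → Set p) → (∀ i → P (i ↑ˡ n)) → (∀ j → P (m ↑ʳ j)) → ∀ k → P k
split-elim m {n} P l r k with splitAt m k in eq
... | inj₁ i = subst P (trans (cong (join m n) (sym eq)) (Fin.join-splitAt m n k)) (l i)
... | inj₂ j = subst P (trans (cong (join m n) (sym eq)) (Fin.join-splitAt m n k)) (r j)

module DecidableChains {A : Set} (_≟_ : DecidableEquality A) (0# : A) where

  open Chains {A = A} _≡_ 0# public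

  ¬supp⇒zero : ∀ {n} (x : Chain n) i → ¬ supp x i → x i ≡ 0#
  ¬supp⇒zero x i = decidable-stable (x i ≟ 0#)

  ¬nonzero⇒zero : ∀ {n} (x : Chain n) → ¬ NonZeroChain x → ∀ i → x i ≡ 0#
  ¬nonzero⇒zero x ¬nz i = ¬supp⇒zero x i λ x≢0 → ¬nz (i , x≢0)

  nonzero? : ∀ {n} (x : Chain n) → Dec (NonZeroChain x)
  nonzero? x = Fin.any? λ i → ¬? (x i ≟ 0#)

  cocircuit-resp : ∀ {n} {C D : Chain n → Set} → (∀ x → C x → D x) → (∀ x → D x → C x) →
                   ∀ {X} → IsCocircuitOf C X → IsCocircuitOf D X
  cocircuit-resp f g (x , (Cx , nz , minimal) , X⇔) = x , (f x Cx , nz , λ y Dy → minimal y (g y Dy)) , X⇔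

  -- Stated for two abstract embeddings covering the ground set, so that left and right summands
  -- share one argument.
  module Summand {m n k : ℕ} (ι : Fin m → Fin k) (κ : Fin n → Fin k)
    (cover : ∀ (P : Fin k → Set) → (∀ i → P (ι i)) → (∀ j → P (κ j)) → ∀ e → P e)
    (pad : Chain m → Chain k) (pad-ι : ∀ c i → pad c (ι i) ≡ c i) (pad-κ : ∀ c j → pad c (κ j) ≡ 0#)
    {C₁ : Chain m → Set} {C : Chain k → Set}
    (restrict : ∀ x → C x → C₁ (x ∘ ι)) (extend : ∀ c → C₁ c → C (pad c))
    where

    pad-supp : ∀ {c : Chain m} {P : Fin k → Set} → (∀ i → supp c i → P (ι i)) → ∀ e → supp (pad c) e → P e
    pad-supp {c} {P} f = cover (λ e → supp (pad c) e → P e)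
      (λ i ne → f i (λ eq → ne (trans (pad-ι c i) eq)))
      (λ j ne → ⊥-elim (ne (pad-κ c j)))

    pad-supp-ι : ∀ (c : Chain m) i → supp c i → supp (pad c) (ι i)
    pad-supp-ι c i ne eq = ne (trans (sym (pad-ι c i)) eq)

    pad-elementary : ∀ c → Elementary C₁ c → Elementary C (pad c)
    pad-elementary c (C₁c , (i , ci) , minimal) = extend c C₁c , (ι i , pad-supp-ι c i ci) , λ where
      x Cx ((e , xe) , sub , e′ , pe′ , ¬xe′) →
        minimal (x ∘ ι) (restrict x Cx)
          ( pad-supp {c} {λ e → supp x e → NonZeroChain (x ∘ ι)} (λ i _ xi → i , xi) e (sub e xe) xe
          , (λ i xi eq → sub (ι i) xi (trans (pad-ι c i) eq))
          , pad-supp {c} {λ e → ¬ supp x e → ∃ λ i → supp c i × ¬ supp (x ∘ ι) i} (λ i ci ¬xi → i , ci , ¬xi) e′ pe′ ¬xe′ )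

    -- Restricting `x` to one summand and padding with zeros gives a chain again. Its support lies
    -- in that of `x`, so by minimality `x` has nothing on the other summand.
    restrict-elementary : ∀ x → Elementary C x → NonZeroChain (x ∘ ι) →
                          Elementary C₁ (x ∘ ι) × (∀ j → x (κ j) ≡ 0#)
    restrict-elementary x (Cx , _ , minimal) nz@(i₀ , x₀) =
      ( restrict x Cx , nz , λ where
          c C₁c ((i , ci) , sub , i′ , xi′ , ¬ci′) → minimal (pad c) (extend c C₁c)
            ( (ι i , pad-supp-ι c i ci)
            , pad-supp {c} {supp x} sub
            , ι i′ , xi′ , λ ne → ¬ci′ (λ eq → ne (trans (pad-ι c i′) eq)) ) )
      , λ j → ¬supp⇒zero x (κ j) λ xj → minimal (pad (x ∘ ι)) (extend (x ∘ ι) (restrict x Cx))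
            ( (ι i₀ , pad-supp-ι (x ∘ ι) i₀ x₀)
            , pad-supp {x ∘ ι} {supp x} (λ i xi → xi)
            , κ j , xj , λ ne → ne (pad-κ (x ∘ ι) j) )

  module DirectSum {m n : ℕ} {C₁ : Chain m → Set} {C₂ : Chain n → Set}
    (resp₁ : ∀ x y → (∀ i → x i ≡ y i) → C₁ x → C₁ y) (zero₁ : C₁ (λ _ → 0#))
    (resp₂ : ∀ x y → (∀ i → x i ≡ y i) → C₂ x → C₂ y) (zero₂ : C₂ (λ _ → 0#))
    where

    C : Chain (m +ℕ n) → Set
    C x = C₁ (x ∘ (_↑ˡ n)) × C₂ (x ∘ (m ↑ʳ_))

    padˡ : Chain m → Chain (m +ℕ n)
    padˡ c = [ c , (λ _ → 0#) ]′ ∘ splitAt m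

    padʳ : Chain n → Chain (m +ℕ n)
    padʳ c = [ (λ _ → 0#) , c ]′ ∘ splitAt m

    padˡ-↑ˡ : ∀ c i → padˡ c (i ↑ˡ n) ≡ c i
    padˡ-↑ˡ c i = cong [ c , (λ _ → 0#) ]′ (Fin.splitAt-↑ˡ m i n)

    padˡ-↑ʳ : ∀ c j → padˡ c (m ↑ʳ j) ≡ 0#
    padˡ-↑ʳ c j = cong [ c , (λ _ → 0#) ]′ (Fin.splitAt-↑ʳ m n j)

    padʳ-↑ˡ : ∀ c i → padʳ c (i ↑ˡ n) ≡ 0#
    padʳ-↑ˡ c i = cong [ (λ _ → 0#) , c ]′ (Fin.splitAt-↑ˡ m i n)

    padʳ-↑ʳ : ∀ c j → padʳ c (m ↑ʳ j) ≡ c j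
    padʳ-↑ʳ c j = cong [ (λ _ → 0#) , c ]′ (Fin.splitAt-↑ʳ m n j)

    module Left = Summand {m} {n} (_↑ˡ n) (m ↑ʳ_) (split-elim m) padˡ padˡ-↑ˡ padˡ-↑ʳ {C₁} {C}
      (λ x → proj₁)
      (λ c C₁c → resp₁ _ _ (λ i → sym (padˡ-↑ˡ c i)) C₁c , resp₂ _ _ (λ j → sym (padˡ-↑ʳ c j)) zero₂)

    module Right = Summand {n} {m} (m ↑ʳ_) (_↑ˡ n) (λ P l r → split-elim m P r l) padʳ padʳ-↑ʳ padʳ-↑ˡ {C₂} {C}
      (λ x → proj₂)
      (λ c C₂c → resp₁ _ _ (λ i → sym (padʳ-↑ˡ c i)) zero₁ , resp₂ _ _ (λ j → sym (padʳ-↑ʳ c j)) C₂c)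

    elementary-cases : ∀ x → Elementary C x →
      (Elementary C₁ (x ∘ (_↑ˡ n)) × (∀ j → x (m ↑ʳ j) ≡ 0#)) ⊎ (Elementary C₂ (x ∘ (m ↑ʳ_)) × (∀ i → x (i ↑ˡ n) ≡ 0#))
    elementary-cases x el@(_ , (e , xe) , _) with nonzero? (x ∘ (_↑ˡ n)) | nonzero? (x ∘ (m ↑ʳ_))
    ... | yes nz | _ = inj₁ (Left.restrict-elementary x el nz)
    ... | no _ | yes nz = inj₂ (Right.restrict-elementary x el nz)
    ... | no zˡ | no zʳ = ⊥-elim (xe (split-elim m (λ e → x e ≡ 0#) (¬nonzero⇒zero _ zˡ) (¬nonzero⇒zero _ zʳ) e))

    cocircuits : ∀ X → (IsCocircuitOf C₁ ⊕ IsCocircuitOf C₂) X ⇔ IsCocircuitOf C X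
    cocircuits X = mk⇔ to (from X)
      where
      to : (IsCocircuitOf C₁ ⊕ IsCocircuitOf C₂) X → IsCocircuitOf C X
      to (inj₁ (Y , refl , c , el , Y⇔)) = padˡ c , Left.pad-elementary c el , split-elim m _
        (λ i → mk⇔
          (λ i∈ → Left.pad-supp-ι c i (Equivalence.to (Y⇔ i) (Equivalence.to (∈-++ˡ Y ∅ i) i∈)))
          (λ ne → Equivalence.from (∈-++ˡ Y ∅ i) (Equivalence.from (Y⇔ i) (λ eq → ne (trans (padˡ-↑ˡ c i) eq)))))
        (λ j → mk⇔
          (λ j∈ → ⊥-elim (∉⊥ (Equivalence.to (∈-++ʳ Y ∅ j) j∈)))
          (λ ne → ⊥-elim (ne (padˡ-↑ʳ c j))))
      to (inj₂ (Z , refl , c , el , Z⇔)) = padʳ c , Right.pad-elementary c el , split-elim m _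
        (λ i → mk⇔
          (λ i∈ → ⊥-elim (∉⊥ (Equivalence.to (∈-++ˡ ∅ Z i) i∈)))
          (λ ne → ⊥-elim (ne (padʳ-↑ˡ c i))))
        (λ j → mk⇔
          (λ j∈ → Right.pad-supp-ι c j (Equivalence.to (Z⇔ j) (Equivalence.to (∈-++ʳ (∅ {m}) Z j) j∈)))
          (λ ne → Equivalence.from (∈-++ʳ (∅ {m}) Z j) (Equivalence.from (Z⇔ j) (λ eq → ne (trans (padʳ-↑ʳ c j) eq)))))
      from : ∀ X → IsCocircuitOf C X → (IsCocircuitOf C₁ ⊕ IsCocircuitOf C₂) X
      from X (x , el , X⇔) with Vec.splitAt m X | elementary-cases x el
      ... | Y , Z , refl | inj₁ (el₁ , x≡0) = inj₁ (Y , cong (Y ++_) Z≡∅ , x ∘ (_↑ˡ n) , el₁ , λ i → mk⇔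
          (λ i∈ → Equivalence.to (X⇔ _) (Equivalence.from (∈-++ˡ Y Z i) i∈))
          (λ ne → Equivalence.to (∈-++ˡ Y Z i) (Equivalence.from (X⇔ _) ne)))
        where
        Z≡∅ : Z ≡ ∅
        Z≡∅ = Empty-unique λ { (j , j∈) → Equivalence.to (X⇔ _) (Equivalence.from (∈-++ʳ Y Z j) j∈) (x≡0 j) }
      ... | Y , Z , refl | inj₂ (el₂ , x≡0) = inj₂ (Z , cong (_++ Z) Y≡∅ , x ∘ (m ↑ʳ_) , el₂ , λ j → mk⇔
          (λ j∈ → Equivalence.to (X⇔ _) (Equivalence.from (∈-++ʳ Y Z j) j∈))
          (λ ne → Equivalence.to (∈-++ʳ Y Z j) (Equivalence.from (X⇔ _) ne)))
        where
        Y≡∅ : Y ≡ ∅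
        Y≡∅ = Empty-unique λ { (i , i∈) → Equivalence.to (X⇔ _) (Equivalence.from (∈-++ˡ Y Z i) i∈) (x≡0 i) }

-- The geometry over ℍ and over H₃

_≟ℍ_ : DecidableEquality ℍ
quat a b c d ≟ℍ quat a′ b′ c′ d′ = map′
  (λ { (refl , refl , refl , refl) → refl })
  (λ { refl → refl , refl , refl , refl })
  (a ℚ.≟ a′ ×-dec b ℚ.≟ b′ ×-dec c ℚ.≟ c′ ×-dec d ℚ.≟ d′)

_≟H₃_ : DecidableEquality H₃
⟨ a , b , c , d ⟩ ≟H₃ ⟨ a′ , b′ , c′ , d′ ⟩ = map′
  (λ { (refl , refl , refl , refl) → refl })
  (λ { refl → refl , refl , refl , refl })
  (a ≟₃ a′ ×-dec b ≟₃ b′ ×-dec c ≟₃ c′ ×-dec d ≟₃ d′)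

ℚ-2-torsion-free : ∀ x → x +ℚ x ≡ 0ℚ → x ≡ 0ℚ
ℚ-2-torsion-free x eq with ℚ.<-cmp x 0ℚ
... | tri< x<0 _ _ = ⊥-elim (ℚ.<-irrefl eq (ℚ.+-mono-< x<0 x<0))
... | tri≈ _ x≡0 _ = x≡0
... | tri> _ _ x>0 = ⊥-elim (ℚ.<-irrefl (sym eq) (ℚ.+-mono-< x>0 x>0))

ℍ-Q₈-ring : Q₈-Ring
ℍ-Q₈-ring = record
  { A = ℍ ; _+_ = _+ℍ_ ; _*_ = _*ℍ_ ; -_ = -ℍ_ ; 0# = 0ℍ ; 1# = 1ℍ
  ; isRing = ℍ-isRing
  ; _≟_ = _≟ℍ_
  ; 1≢0 = λ ()
  ; 2-torsion-free = λ { (quat a b c d) eq → ≡quat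
      (ℚ-2-torsion-free a (cong ℍ.re eq)) (ℚ-2-torsion-free b (cong ℍ.im-i eq))
      (ℚ-2-torsion-free c (cong ℍ.im-j eq)) (ℚ-2-torsion-free d (cong ℍ.im-k eq)) }
  ; q = quaternionGroup
  ; q-one = refl
  ; q-minus-one = refl
  ; q-mul = from-yes (Fin.all? λ m → Fin.all? λ n → (quaternionGroup m *ℍ quaternionGroup n) ≟ℍ quaternionGroup (m · n))
  }
  where
  ≡quat : ∀ {a b c d a′ b′ c′ d′} → a ≡ a′ → b ≡ b′ → c ≡ c′ → d ≡ d′ → quat a b c d ≡ quat a′ b′ c′ d′
  ≡quat refl refl refl refl = refl

𝔽₃-2-torsion-free : ∀ x → x +₃ x ≡ z₃ → x ≡ z₃
𝔽₃-2-torsion-free z₃ _ = refl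

Q₈→H₃ : Q₈ → H₃
Q₈→H₃ m = lookup
  ( ⟨ o₃ , z₃ , z₃ , z₃ ⟩ ∷ ⟨ t₃ , z₃ , z₃ , z₃ ⟩
  ∷ ⟨ z₃ , o₃ , z₃ , z₃ ⟩ ∷ ⟨ z₃ , t₃ , z₃ , z₃ ⟩
  ∷ ⟨ z₃ , z₃ , o₃ , z₃ ⟩ ∷ ⟨ z₃ , z₃ , t₃ , z₃ ⟩
  ∷ ⟨ z₃ , z₃ , z₃ , o₃ ⟩ ∷ ⟨ z₃ , z₃ , z₃ , t₃ ⟩ ∷ [] ) m

H₃-Q₈-ring : Q₈-Ring
H₃-Q₈-ring = record
  { A = H₃ ; _+_ = _+q_ ; _*_ = _*q_ ; -_ = -q_ ; 0# = 0q ; 1# = 1q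
  ; isRing = H₃-isRing
  ; _≟_ = _≟H₃_
  ; 1≢0 = λ ()
  ; 2-torsion-free = λ { ⟨ a , b , c , d ⟩ eq → ⟨⟩-cong
      (𝔽₃-2-torsion-free a (cong q₀ eq)) (𝔽₃-2-torsion-free b (cong q₁ eq))
      (𝔽₃-2-torsion-free c (cong q₂ eq)) (𝔽₃-2-torsion-free d (cong q₃ eq)) }
  ; q = Q₈→H₃
  ; q-one = refl
  ; q-minus-one = refl
  ; q-mul = from-yes (Fin.all? λ m → Fin.all? λ n → (Q₈→H₃ m *q Q₈→H₃ n) ≟H₃ Q₈→H₃ (m · n))
  }

module Dℍ = Dowling ℍ-Q₈-ring
module D₃ = Dowling H₃-Q₈-ring

open RowSpace 0ℍ _+ℍ_ _*ℍ_ using () renaming (sumF to sumℍ; RowSpaceOf to RowSpaceℍ)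

Q₃-row : ∀ y i → sumℍ (λ t → y t *ℍ Q₃-matrix t i) ≡ Dℍ.value y (point i)
Q₃-row y i with splitAt 3 i
... | inj₁ zero = Dℍ.row-joint₀ (y (# 0)) (y (# 1)) (y (# 2))
... | inj₁ (suc zero) = Dℍ.row-joint₁ (y (# 0)) (y (# 1)) (y (# 2))
... | inj₁ (suc (suc zero)) = Dℍ.row-joint₂ (y (# 0)) (y (# 1)) (y (# 2))
... | inj₂ i′ with splitAt 8 i′
...   | inj₁ m = Dℍ.row-on₀ (y (# 0)) (y (# 1)) (y (# 2)) (quaternionGroup m)
...   | inj₂ i″ with splitAt 8 i″
...     | inj₁ m = Dℍ.row-on₁ (y (# 0)) (y (# 1)) (y (# 2)) (quaternionGroup m)
...     | inj₂ m = Dℍ.row-on₂ (y (# 0)) (y (# 1)) (y (# 2)) (quaternionGroup m)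

Q₃-cocircuit : ∀ X → Q₃G X ⇔ ∃ λ l → Avoids l X
Q₃-cocircuit X = mk⇔
  (λ c → Equivalence.to (Dℍ.cocircuit⇔ X) (cocircuit-resp to from c))
  (λ l → cocircuit-resp from to (Equivalence.from (Dℍ.cocircuit⇔ X) l))
  where
  open DecidableChains _≟ℍ_ 0ℍ
  to : ∀ x → RowSpaceℍ Q₃-matrix x → Dℍ.DowlingChain x
  to x (y , x≡) = y , λ i → trans (x≡ i) (Q₃-row y i)
  from : ∀ x → Dℍ.DowlingChain x → RowSpaceℍ Q₃-matrix x
  from x (y , x≡) = y , λ i → trans (x≡ i) (sym (Q₃-row y i))

H₃-ring : Ring 0ℓ 0ℓ
H₃-ring = Q₈-Ring.ring H₃-Q₈-ring

Unit₃ : H₃ → Set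
Unit₃ = IsUnit H₃-ring

module _ where
  open Q₈-Ring H₃-Q₈-ring
  open D₃ using (q?; evaluate)

  Inverses : H₃ → H₃ → Set
  Inverses x y = (x * y ≡ 1#) × (y * x ≡ 1#)

  inverses? : ∀ x y → Dec (Inverses x y)
  inverses? x y = ((x * y) ≟ 1#) ×-dec ((y * x) ≟ 1#)

  -- The norm of a difference of distinct elements of Q₈ ∪ {0} is 1, 2 or 4, hence
  -- ±1 in characteristic 3, so that it is its own inverse.
  invert : H₃ → H₃
  invert x = x * x̄ * x̄
    where
    x̄ = ⟨ q₀ x , -₃ q₁ x , -₃ q₂ x , -₃ q₃ x ⟩

  difference : ∀ a b → Unit₃ (- q? a + q? b) ⊎ a ≡ b
  difference nothing nothing = inj₂ refl
  difference nothing (just n) = inj₁ (_ , inverse n)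
    where
    inverse : ∀ n → Inverses (- q? nothing + q n) (invert (- q? nothing + q n))
    inverse = from-yes (Fin.all? λ n → inverses? (- q? nothing + q n) (invert (- q? nothing + q n)))
  difference (just m) nothing = inj₁ (_ , inverse m)
    where
    inverse : ∀ m → Inverses (- q m + q? nothing) (invert (- q m + q? nothing))
    inverse = from-yes (Fin.all? λ m → inverses? (- q m + q? nothing) (invert (- q m + q? nothing)))
  difference (just m) (just n) with m Fin.≟ n
  ... | yes m≡n = inj₂ (cong just m≡n)
  ... | no m≢n = inj₁ (_ , inverse m n m≢n)
    where
    inverse : ∀ m n → m ≢ n → Inverses (- q m + q n) (invert (- q m + q n))
    inverse = from-yes (Fin.all? λ m → Fin.all? λ n → ¬? (m Fin.≟ n) →-dec
      inverses? (- q m + q n) (invert (- q m + q n)))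

  difference-primitive : ∀ a b → Unit₃ (- q? a + q? b) ⊎ - q? a + q? b ≡ 0#
  difference-primitive a b with difference a b
  ... | inj₁ u = inj₁ u
  ... | inj₂ refl = inj₂ (-‿inverseˡ (q? a))

  -- With the factor 1, each entry is a difference of two elements of Q₈ ∪ {0}.
  evaluate-primitive : ∀ l i → Unit₃ (evaluate l i) ⊎ evaluate l i ≡ 0#
  evaluate-primitive l i = go (point i)
    where
    s = covector l
    go : ∀ p → Unit₃ (D₃.value (D₃.scale 1# s) p) ⊎ D₃.value (D₃.scale 1# s) p ≡ 0#
    -- An entry at a joint counts as a difference from 0, since - 0 + x reduces to x in H₃.
    go (joint t) = subst (λ x → Unit₃ x ⊎ x ≡ 0#) (sym (*-identityˡ (q? (s t)))) (difference-primitive nothing (s t))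
    go (on t m) = subst (λ x → Unit₃ x ⊎ x ≡ 0#)
      (sym (cong₂ _+_ (cong -_ (*-identityˡ (q? (s t))))
                      (trans (D₃.*q?*q 1# (s (σ t)) m) (*-identityˡ (q? (s (σ t) ·? m))))))
      (difference-primitive (s t) (s (σ t) ·? m))

-- Extension of scalars from GF(3)

record Subspace {n : ℕ} (C : (Fin n → 𝔽₃) → Set) : Set where
  field
    resp₃ : ∀ x y → (∀ i → x i ≡ y i) → C x → C y
    0∈ : C (λ _ → z₃)
    +∈ : ∀ x y → C x → C y → C (λ i → x i +₃ y i)
    *∈ : ∀ r x → C x → C (λ i → r *₃ x i)

open RowSpace z₃ _+₃_ _*₃_ using () renaming (sumF to sum₃; RowSpaceOf to RowSpace₃)
open CommutativeRing 𝔽₃-commutativeRing using () renaming (*-assoc to *₃-assoc; distribˡ to *₃-distribˡ; distribʳ to *₃-distribʳ; +-commutativeSemigroup to +₃-commutativeSemigroup; zeroʳ to *₃-zeroʳ)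
open CommutativeSemigroupProperties +₃-commutativeSemigroup using () renaming (interchange to +₃-interchange)

sum₃-+ : ∀ {r} (u v w : Fin r → 𝔽₃) → sum₃ (λ i → (u i +₃ v i) *₃ w i) ≡ sum₃ (λ i → u i *₃ w i) +₃ sum₃ (λ i → v i *₃ w i)
sum₃-+ {zero} u v w = refl
sum₃-+ {suc r} u v w = trans
  (cong₂ _+₃_ (*₃-distribʳ (w zero) (u zero) (v zero)) (sum₃-+ (u ∘ suc) (v ∘ suc) (w ∘ suc)))
  (+₃-interchange (u zero *₃ w zero) (v zero *₃ w zero) (sum₃ (λ i → u (suc i) *₃ w (suc i))) (sum₃ (λ i → v (suc i) *₃ w (suc i))))

sum₃-* : ∀ {r} a (u w : Fin r → 𝔽₃) → sum₃ (λ i → (a *₃ u i) *₃ w i) ≡ a *₃ sum₃ (λ i → u i *₃ w i)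
sum₃-* {zero} a u w = sym (*₃-zeroʳ a)
sum₃-* {suc r} a u w = trans
  (cong₂ _+₃_ (*₃-assoc a (u zero) (w zero)) (sum₃-* a (u ∘ suc) (w ∘ suc)))
  (sym (*₃-distribˡ a (u zero *₃ w zero) (sum₃ (λ i → u (suc i) *₃ w (suc i)))))

sum₃-0 : ∀ r → sum₃ {r} (λ _ → z₃) ≡ z₃
sum₃-0 zero = refl
sum₃-0 (suc r) = sum₃-0 r

rowSpace-subspace : ∀ {r n} (B : Fin r → Fin n → 𝔽₃) → Subspace (RowSpace₃ B)
rowSpace-subspace {r} B = record
  { resp₃ = λ { x y eq (u , x≡) → u , λ i → trans (sym (eq i)) (x≡ i) }
  ; 0∈ = (λ _ → z₃) , λ i → sym (sum₃-0 r)
  ; +∈ = λ { x y (u , x≡) (v , y≡) → (λ t → u t +₃ v t) , λ i → trans (cong₂ _+₃_ (x≡ i) (y≡ i)) (sym (sum₃-+ u v (λ t → B t i))) }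
  ; *∈ = λ { a x (u , x≡) → (λ t → a *₃ u t) , λ i → trans (cong (a *₃_) (x≡ i)) (sym (sum₃-* a u (λ t → B t i))) }
  }

coordinate : Fin 4 → H₃ → 𝔽₃
coordinate zero = q₀
coordinate (suc zero) = q₁
coordinate (suc (suc zero)) = q₂
coordinate (suc (suc (suc zero))) = q₃

coordinates-zero : ∀ x → (∀ k → coordinate k x ≡ z₃) → x ≡ 0q
coordinates-zero x eq = ⟨⟩-cong (eq (# 0)) (eq (# 1)) (eq (# 2)) (eq (# 3))

scalar : 𝔽₃ → H₃
scalar a = ⟨ a , z₃ , z₃ , z₃ ⟩

scalar-mul : ∀ x s → x *q scalar s ≡ ⟨ q₀ x *₃ s , q₁ x *₃ s , q₂ x *₃ s , q₃ x *₃ s ⟩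
scalar-mul = λ { ⟨ a , b , c , d ⟩ s → table a b c d s }
  where
  table : ∀ a b c d s → ⟨ a , b , c , d ⟩ *q scalar s ≡ ⟨ a *₃ s , b *₃ s , c *₃ s , d *₃ s ⟩
  table = from-yes (all₃? λ a → all₃? λ b → all₃? λ c → all₃? λ d → all₃? λ s →
    (⟨ a , b , c , d ⟩ *q scalar s) ≟H₃ ⟨ a *₃ s , b *₃ s , c *₃ s , d *₃ s ⟩)

cancel-square : ∀ a b → a ≢ z₃ → b +₃ (-₃ ((b *₃ a) *₃ a)) ≡ z₃
cancel-square = from-yes (all₃? λ a → all₃? λ b → ¬? (a ≟₃ z₃) →-dec ((b +₃ (-₃ ((b *₃ a) *₃ a))) ≟₃ z₃))

subtract-zero : ∀ a b → a +₃ (-₃ b) ≡ z₃ → a ≡ b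
subtract-zero = from-yes (all₃? λ a → all₃? λ b → ((a +₃ (-₃ b)) ≟₃ z₃) →-dec (a ≟₃ b))

module ExtendScalars {n : ℕ} {C : (Fin n → 𝔽₃) → Set} (subspace : Subspace C) where
  open Subspace subspace
  private
    module F = DecidableChains _≟₃_ z₃
    module H = DecidableChains _≟H₃_ 0q

  -- H₃ is free over GF(3) on 1, i, j, k, so the extension of scalars can be tested coordinate by
  -- coordinate.
  C⊗H : H.Chain n → Set
  C⊗H x = ∀ k → C (coordinate k ∘ x)

  scalar-∈ : ∀ c → C c → C⊗H (scalar ∘ c)
  scalar-∈ c Cc zero = Cc
  scalar-∈ c Cc (suc zero) = 0∈
  scalar-∈ c Cc (suc (suc zero)) = 0∈
  scalar-∈ c Cc (suc (suc (suc zero))) = 0∈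

  supp-scalar : ∀ (c : F.Chain n) i → F.supp c i → H.supp (scalar ∘ c) i
  supp-scalar c i ci eq = ci (cong q₀ eq)

  scalar-supp : ∀ (c : F.Chain n) i → H.supp (scalar ∘ c) i → F.supp c i
  scalar-supp c i ci eq = ci (cong scalar eq)

  coordinate-supp : ∀ (x : H.Chain n) k i → F.supp (coordinate k ∘ x) i → H.supp x i
  coordinate-supp x k i ne eq = ne (trans (cong (coordinate k) eq) (coordinate-0 k))
    where
    coordinate-0 : ∀ k → coordinate k 0q ≡ z₃
    coordinate-0 = from-yes (Fin.all? λ k → coordinate k 0q ≟₃ z₃)

  supp-coordinate : ∀ (x : H.Chain n) i → H.supp x i → ∃ λ k → F.supp (coordinate k ∘ x) i
  supp-coordinate x i xi with Fin.any? (λ k → ¬? (coordinate k (x i) ≟₃ z₃))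
  ... | yes found = found
  ... | no none = contradiction
    (coordinates-zero (x i) (λ k → decidable-stable (coordinate k (x i) ≟₃ z₃) (λ ne → none (k , ne)))) xi

  scalar-elementary : ∀ c → F.Elementary C c → H.Elementary C⊗H (scalar ∘ c)
  scalar-elementary c (Cc , (i , ci) , minimal) = scalar-∈ c Cc , (i , supp-scalar c i ci) , λ where
    x Cx ((j , xj) , sub , j′ , cj′ , ¬xj′) → let k , xjk = supp-coordinate x j xj in
      minimal (coordinate k ∘ x) (Cx k)
        ( (j , xjk)
        , (λ i xi → scalar-supp c i (sub i (coordinate-supp x k i xi)))
        , j′ , scalar-supp c j′ cj′ , λ xj′ → ¬xj′ (coordinate-supp x k j′ xj′) )

  proportional : ∀ c x → F.Elementary C c → C x → (∀ i → F.supp x i → F.supp c i) → ∃ λ a → ∀ i → x i ≡ a *₃ c i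
  proportional c x (Cc , (i₀ , c₀) , minimal) Cx sub = a , λ i → subtract-zero (x i) (a *₃ c i) (F.¬nonzero⇒zero y y-zero i)
    where
    -- A nonzero element of GF(3) is its own inverse, so this is the quotient of `x i₀` by `c i₀`,
    -- and `y` vanishes at `i₀`.
    a = x i₀ *₃ c i₀
    y : F.Chain n
    y i = x i +₃ (-₃ (a *₃ c i))
    y-sub : ∀ i → F.supp y i → F.supp c i
    y-sub i yi ci = yi (cong₂ _+₃_ (decidable-stable (x i ≟₃ z₃) (λ xi → sub i xi ci)) (cong -₃_ (trans (cong (a *₃_) ci) (*₃-zeroʳ a))))
    y-zero : ¬ F.NonZeroChain y
    y-zero nz = minimal y (+∈ x _ Cx (*∈ t₃ _ (*∈ a c Cc)))
      (nz , y-sub , i₀ , c₀ , λ y₀ → y₀ (cancel-square (c i₀) (x i₀) c₀))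

  -- Any nonzero coordinate of `x`, viewed as a chain over H₃, is a chain of the extension supported
  -- within `x`; minimality makes the two supports equal.
  elementary-coordinate : ∀ x → H.Elementary C⊗H x → ∃ λ c → F.Elementary C c × (∀ i → F.supp c i ⇔ H.supp x i)
  elementary-coordinate x (Cx , (i , xi) , minimal) = c , el , λ i → mk⇔ (coordinate-supp x k i) (same i)
    where
    k = proj₁ (supp-coordinate x i xi)
    c = coordinate k ∘ x
    ci : F.supp c i
    ci = proj₂ (supp-coordinate x i xi)
    same : ∀ j → H.supp x j → F.supp c j
    same j xj cj = minimal (scalar ∘ c) (scalar-∈ c (Cx k))
      ( (i , supp-scalar c i ci)
      , (λ i ci → coordinate-supp x k i (scalar-supp c i ci))
      , j , xj , λ ne → ne (cong scalar cj) )
    el : F.Elementary C c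
    el = Cx k , (i , ci) , λ where
      y Cy ((j , yj) , sub , j′ , cj′ , ¬yj′) → minimal (scalar ∘ y) (scalar-∈ y Cy)
        ( (j , supp-scalar y j yj)
        , (λ i yi → coordinate-supp x k i (sub i (scalar-supp y i yi)))
        , j′ , coordinate-supp x k j′ cj′ , λ yj′ → ¬yj′ (scalar-supp y j′ yj′) )

  -- Each of the four coordinates of `x` is a GF(3)-multiple of the same `c`; the four factors are
  -- the coordinates of `r`.
  elementary-multiple : ∀ x → H.Elementary C⊗H x → ∃ λ c → F.Elementary C c × (∃ λ r → ∀ i → x i ≡ r *q scalar (c i))
  elementary-multiple x el@(Cx , _) = c , el-c , ⟨ a (# 0) , a (# 1) , a (# 2) , a (# 3) ⟩ , λ i →
    trans (⟨⟩-cong (x≡ (# 0) i) (x≡ (# 1) i) (x≡ (# 2) i) (x≡ (# 3) i)) (sym (scalar-mul _ (c i)))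
    where
    c = proj₁ (elementary-coordinate x el)
    el-c = proj₁ (proj₂ (elementary-coordinate x el))
    c⇔x = proj₂ (proj₂ (elementary-coordinate x el))
    multiple : ∀ k → ∃ λ a → ∀ i → coordinate k (x i) ≡ a *₃ c i
    multiple k = proportional c (coordinate k ∘ x) el-c (Cx k) (λ i xi → Equivalence.from (c⇔x i) (coordinate-supp x k i xi))
    a = λ k → proj₁ (multiple k)
    x≡ = λ k → proj₂ (multiple k)

  cocircuit⇔ : ∀ X → F.IsCocircuitOf C X ⇔ H.IsCocircuitOf C⊗H X
  cocircuit⇔ X = mk⇔
    (λ { (c , el , X⇔) → scalar ∘ c , scalar-elementary c el , λ i →
      mk⇔ (λ i∈ → supp-scalar c i (Equivalence.to (X⇔ i) i∈)) (λ ne → Equivalence.from (X⇔ i) (scalar-supp c i ne)) })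
    (λ { (x , el , X⇔) → let c , el-c , c⇔x = elementary-coordinate x el in
      c , el-c , λ i → mk⇔ (λ i∈ → Equivalence.from (c⇔x i) (Equivalence.to (X⇔ i) i∈))
                           (λ ci → Equivalence.from (X⇔ i) (Equivalence.to (c⇔x i) ci)) })

  -∈ : ∀ x → C x → C (λ i → -₃ x i)
  -∈ x = *∈ t₃ x

  isChainGroup : IsChainGroup H₃-ring C⊗H
  isChainGroup = record
    { respects = λ x y eq Cx k → resp₃ _ _ (λ i → cong (coordinate k) (eq i)) (Cx k)
    ; has-zero = λ { zero → 0∈ ; (suc zero) → 0∈ ; (suc (suc zero)) → 0∈ ; (suc (suc (suc zero))) → 0∈ }
    ; +-closed = λ { x y Cx Cy zero → +∈ _ _ (Cx (# 0)) (Cy (# 0))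
                   ; x y Cx Cy (suc zero) → +∈ _ _ (Cx (# 1)) (Cy (# 1))
                   ; x y Cx Cy (suc (suc zero)) → +∈ _ _ (Cx (# 2)) (Cy (# 2))
                   ; x y Cx Cy (suc (suc (suc zero))) → +∈ _ _ (Cx (# 3)) (Cy (# 3)) }
    ; *-closed = *-closed
    }
    where
    *-closed : ∀ r x → C⊗H x → C⊗H (λ i → r *q x i)
    -- The nesting copies the formula of `_*q_`: each coordinate of r x is a GF(3)-combination of
    -- the coordinates of x.
    *-closed r x Cx zero =
      +∈ _ _ (+∈ _ _ (*∈ (q₀ r) _ (Cx (# 0))) (-∈ _ (*∈ (q₁ r) _ (Cx (# 1)))))
             (-∈ _ (+∈ _ _ (*∈ (q₂ r) _ (Cx (# 2))) (*∈ (q₃ r) _ (Cx (# 3)))))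
    *-closed r x Cx (suc zero) =
      +∈ _ _ (+∈ _ _ (*∈ (q₀ r) _ (Cx (# 1))) (*∈ (q₁ r) _ (Cx (# 0))))
             (+∈ _ _ (*∈ (q₂ r) _ (Cx (# 3))) (-∈ _ (*∈ (q₃ r) _ (Cx (# 2)))))
    *-closed r x Cx (suc (suc zero)) =
      +∈ _ _ (+∈ _ _ (*∈ (q₀ r) _ (Cx (# 2))) (-∈ _ (*∈ (q₁ r) _ (Cx (# 3)))))
             (+∈ _ _ (*∈ (q₂ r) _ (Cx (# 0))) (*∈ (q₃ r) _ (Cx (# 1))))
    *-closed r x Cx (suc (suc (suc zero))) =
      +∈ _ _ (+∈ _ _ (*∈ (q₀ r) _ (Cx (# 3))) (*∈ (q₁ r) _ (Cx (# 2))))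
             (+∈ _ _ (*∈ (q₃ r) _ (Cx (# 0))) (-∈ _ (*∈ (q₂ r) _ (Cx (# 1)))))

-- The representation of the direct sum over H₃

H₃-partialField : SkewPartialField 0ℓ 0ℓ 0ℓ
H₃-partialField = record
  { ring = H₃-ring
  ; G′ = Unit₃
  ; G′-respects = λ { refl u → u }
  ; G′-units = λ u → u
  ; G′-one = 1q , refl , refl
  ; G′-mul = λ { {x} {y} (x′ , xx′ , x′x) (y′ , yy′ , y′y) → y′ *q x′ ,
      cancel x y y′ x′ yy′ xx′ , cancel y′ x′ x y x′x y′y }
  ; G′-inv = λ {x} {y} _ xy yx → x , yx , xy
  ; G′-minus-one = -q 1q , refl , refl
  }
  where
  open Q₈-Ring H₃-Q₈-ring using (*-assoc; *-identityʳ)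
  open ≡-Reasoning
  cancel : ∀ a b c d → b *q c ≡ 1q → a *q d ≡ 1q → (a *q b) *q (c *q d) ≡ 1q
  cancel a b c d bc ad = begin
    (a *q b) *q (c *q d) ≡⟨ *-assoc (a *q b) c d ⟨
    ((a *q b) *q c) *q d ≡⟨ cong (_*q d) (*-assoc a b c) ⟩
    (a *q (b *q c)) *q d ≡⟨ cong (λ u → (a *q u) *q d) bc ⟩
    (a *q 1q) *q d       ≡⟨ cong (_*q d) (*-identityʳ a) ⟩
    a *q d               ≡⟨ ad ⟩
    1q                   ∎

⊕-map : ∀ {m n} {M₁ N₁ : CocircuitFamily m} {M₂ N₂ : CocircuitFamily n} →
        (∀ Y → M₁ Y → N₁ Y) → (∀ Z → M₂ Z → N₂ Z) → ∀ X → (M₁ ⊕ M₂) X → (N₁ ⊕ N₂) X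
⊕-map f g X = Sum.map (λ { (Y , X≡ , m) → Y , X≡ , f Y m }) (λ { (Z , X≡ , m) → Z , X≡ , g Z m })

module R₉-over-H₃ = ExtendScalars (rowSpace-subspace R₉-matrix)

dowling-isChainGroup : IsChainGroup H₃-ring D₃.DowlingChain
dowling-isChainGroup = record
  { respects = λ { x x′ eq (y , x≡) → y , λ i → trans (sym (eq i)) (x≡ i) }
  ; has-zero = (λ _ → 0q) , λ i → zero-value (point i)
  ; +-closed = λ { x x′ (y , x≡) (y′ , x′≡) → (λ t → y t +q y′ t) ,
      λ i → trans (cong₂ _+q_ (x≡ i) (x′≡ i)) (sym (D₃.value-+ y y′ (point i))) }
  ; *-closed = λ { r x (y , x≡) → (λ t → r *q y t) ,
      λ i → trans (cong (r *q_) (x≡ i)) (sym (D₃.value-* r y (point i))) }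
  }
  where
  zero-value : ∀ p → 0q ≡ D₃.value (λ _ → 0q) p
  zero-value (joint t) = refl
  zero-value (on t m) = sym (D₃.vanishes-on {λ _ → 0q} {t} {m} (sym (Q₈-Ring.zeroˡ H₃-Q₈-ring (Q₈→H₃ m))))

module R₉-chains = IsChainGroup R₉-over-H₃.isChainGroup
module Dowling-chains = IsChainGroup dowling-isChainGroup

module Sum₃ = DecidableChains.DirectSum _≟H₃_ 0q
  (R₉-chains.respects) (R₉-chains.has-zero)
  (Dowling-chains.respects) (Dowling-chains.has-zero)

scalar-primitive : ∀ a → Unit₃ (scalar a) ⊎ scalar a ≡ 0q
scalar-primitive z₃ = inj₂ refl
scalar-primitive o₃ = inj₁ (1q , refl , refl)
scalar-primitive t₃ = inj₁ (-q 1q , refl , refl)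

Sum₃-isPChainGroup : IsPChainGroup H₃-ring Unit₃ Sum₃.C
Sum₃-isPChainGroup = record
  { chainGroup = record
    { respects = λ { x y eq (C₁x , C₂x) →
        R₉-chains.respects _ _ (λ i → eq (i ↑ˡ 27)) C₁x , Dowling-chains.respects _ _ (λ j → eq (9 ↑ʳ j)) C₂x }
    ; has-zero = R₉-chains.has-zero , Dowling-chains.has-zero
    ; +-closed = λ { x y (C₁x , C₂x) (C₁y , C₂y) →
        R₉-chains.+-closed _ _ C₁x C₁y , Dowling-chains.+-closed _ _ C₂x C₂y }
    ; *-closed = λ { r x (C₁x , C₂x) → R₉-chains.*-closed r _ C₁x , Dowling-chains.*-closed r _ C₂x }
    }
  ; elementary-primitive = multiple
  }
  where
  open Q₈-Ring H₃-Q₈-ring using (zeroʳ)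
  open DecidableChains _≟H₃_ 0q
  unit-or-zero : H₃ → Set
  unit-or-zero a = Unit₃ a ⊎ a ≡ 0q
  multiple : ∀ x → Elementary Sum₃.C x →
    ∃ λ r → ∃ λ c → Sum₃.C c × (∀ e → unit-or-zero (c e)) × (∀ e → x e ≡ r *q c e)
  multiple x el with Sum₃.elementary-cases x el
  ... | inj₁ (el₁ , x≡0) =
    let c , el-c , r , x≡ = R₉-over-H₃.elementary-multiple _ el₁
        c′ = scalar ∘ c
    in r , Sum₃.padˡ c′ , proj₁ (Sum₃.Left.pad-elementary c′ (R₉-over-H₃.scalar-elementary c el-c))
     , split-elim 9 _ (λ i → subst unit-or-zero (sym (Sum₃.padˡ-↑ˡ c′ i)) (scalar-primitive (c i)))
                      (λ j → inj₂ (Sum₃.padˡ-↑ʳ c′ j))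
     , split-elim 9 _ (λ i → trans (x≡ i) (cong (r *q_) (sym (Sum₃.padˡ-↑ˡ c′ i))))
                      (λ j → trans (x≡0 j) (sym (trans (cong (r *q_) (Sum₃.padˡ-↑ʳ c′ j)) (zeroʳ r))))
  ... | inj₂ (el₂ , x≡0) =
    let l , _ , r , x≡ = D₃.elementary⇒multiple _ el₂
        c′ = D₃.evaluate l
    in r , Sum₃.padʳ c′ , proj₁ (Sum₃.Right.pad-elementary c′ (D₃.evaluate-elementary l))
     , split-elim 9 _ (λ i → inj₂ (Sum₃.padʳ-↑ˡ c′ i))
                      (λ j → subst unit-or-zero (sym (Sum₃.padʳ-↑ʳ c′ j)) (evaluate-primitive l j))
     , split-elim 9 _ (λ i → trans (x≡0 i) (sym (trans (cong (r *q_) (Sum₃.padʳ-↑ˡ c′ i)) (zeroʳ r))))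
                      (λ j → trans (x≡ j) (cong (r *q_) (sym (Sum₃.padʳ-↑ʳ c′ j))))

representable-over-H₃ : RepresentableOverPF 0ℓ H₃-partialField M-R₉⊕Q₃
representable-over-H₃ = Sum₃.C , Sum₃-isPChainGroup , λ X → mk⇔
  (λ M → Equivalence.to (Sum₃.cocircuits X) (⊕-map
    (λ Y → Equivalence.to (R₉-over-H₃.cocircuit⇔ Y))
    -- The passage from ℍ to H₃ goes through the common list of lines.
    (λ Z → Equivalence.from (D₃.cocircuit⇔ Z) ∘ Equivalence.to (Q₃-cocircuit Z)) X M))
  (λ c → ⊕-map
    (λ Y → Equivalence.from (R₉-over-H₃.cocircuit⇔ Y))
    (λ Z → Equivalence.from (Q₃-cocircuit Z) ∘ Equivalence.to (D₃.cocircuit⇔ Z)) X (Equivalence.from (Sum₃.cocircuits X) c))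

-- Representations over a skew field

-- Equality in a skew field need not be decidable.  As the goal is ⊥, it may be replaced
-- by its double negation, so that the entries outside the support become zero.
module ¬¬-Closure {c ℓ : Level} (R : Ring c ℓ) where
  open Ring R renaming (refl to ≈-refl; sym to ≈-sym; trans to ≈-trans)

  _≈¬¬_ : Carrier → Carrier → Set ℓ
  x ≈¬¬ y = ¬ ¬ (x ≈ y)

  now : ∀ {x y} → x ≈ y → x ≈¬¬ y
  now p k = k p

  map₂ : ∀ {u v x y z w} → (u ≈ v → x ≈ y → z ≈ w) → u ≈¬¬ v → x ≈¬¬ y → z ≈¬¬ w
  map₂ f p q k = p λ p → q λ q → k (f p q)

  closure : Ring c ℓ
  closure = record
    { _≈_ = _≈¬¬_ ; _+_ = _+_ ; _*_ = _*_ ; -_ = -_ ; 0# = 0# ; 1# = 1#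
    ; isRing = record
      { +-isAbelianGroup = record
        { isGroup = record
          { isMonoid = record
            { isSemigroup = record
              { isMagma = record
                { isEquivalence = record
                  { refl = now ≈-refl
                  ; sym = λ p k → p λ p → k (≈-sym p)
                  ; trans = map₂ ≈-trans
                  }
                ; ∙-cong = map₂ +-cong
                }
              ; assoc = λ x y z → now (+-assoc x y z)
              }
            ; identity = (λ x → now (+-identityˡ x)) , (λ x → now (+-identityʳ x))
            }
          ; inverse = (λ x → now (-‿inverseˡ x)) , (λ x → now (-‿inverseʳ x))
          ; ⁻¹-cong = λ p k → p λ p → k (-‿cong p)
          }
        ; comm = λ x y → now (+-comm x y)
        }
      ; *-cong = map₂ *-cong
      ; *-assoc = λ x y z → now (*-assoc x y z)
      ; *-identity = (λ x → now (*-identityˡ x)) , (λ x → now (*-identityʳ x))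
      ; distrib = (λ x y z → now (distribˡ x y z)) , (λ x y z → now (distribʳ x y z))
      }
    }

record IsSkewField {c ℓ} (R : Ring c ℓ) : Set (c ⊔ ℓ) where
  open Ring R
  field
    1≉0 : ¬ (1# ≈ 0#)
    inverse : ∀ x → ¬ (x ≈ 0#) → IsUnit R x

closure-isSkewField : ∀ {c ℓ} (F : SkewField c ℓ) → IsSkewField (¬¬-Closure.closure (SkewField.ring F))
closure-isSkewField F = record
  { 1≉0 = λ p → p 1≉0
  ; inverse = λ x x≉0 → let y , xy , yx = inverse x (λ p → x≉0 (now p)) in y , now xy , now yx
  }
  where
  open SkewField F
  open ¬¬-Closure ring

-- Arithmetic in a skew field

module SkewFieldArithmetic {c ℓ} (R : Ring c ℓ) (isSkew : IsSkewField R) where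
  open Ring R public hiding (refl; zero) renaming (sym to ≈-sym; trans to ≈-trans)
  open IsSkewField isSkew public
  open RingProperties R using (-‿distribˡ-*; -‿distribʳ-*; -‿involutive; -‿+-comm; +-inverseˡ-unique; -0#≈0#)
  open SetoidReasoning setoid

  *-cancelˡ-zero : ∀ {x y} → x ≉ 0# → x * y ≈ 0# → y ≈ 0#
  *-cancelˡ-zero {x} {y} x≉0 xy = let x⁻¹ , _ , x⁻¹x = inverse x x≉0 in begin
    y               ≈⟨ *-identityˡ y ⟨
    1# * y          ≈⟨ *-congʳ x⁻¹x ⟨
    x⁻¹ * x * y     ≈⟨ *-assoc x⁻¹ x y ⟩
    x⁻¹ * (x * y)   ≈⟨ *-congˡ xy ⟩
    x⁻¹ * 0#        ≈⟨ zeroʳ x⁻¹ ⟩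
    0#              ∎

  *-cancelʳ-zero : ∀ {x y} → y ≉ 0# → x * y ≈ 0# → x ≈ 0#
  *-cancelʳ-zero {x} {y} y≉0 xy = let y⁻¹ , yy⁻¹ , _ = inverse y y≉0 in begin
    x               ≈⟨ *-identityʳ x ⟨
    x * 1#          ≈⟨ *-congˡ yy⁻¹ ⟨
    x * (y * y⁻¹)   ≈⟨ *-assoc x y y⁻¹ ⟨
    x * y * y⁻¹     ≈⟨ *-congʳ xy ⟩
    0# * y⁻¹        ≈⟨ zeroˡ y⁻¹ ⟩
    0#              ∎

  opposite : ∀ {x y} → x + y ≈ 0# → x ≈ - y
  opposite {x} {y} = +-inverseˡ-unique x y

  minus⇒≈ : ∀ {x y} → x + - y ≈ 0# → x ≈ y
  minus⇒≈ {x} {y} p = ≈-trans (opposite p) (-‿involutive y)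

  ≈⇒minus : ∀ {x y} → x ≈ y → x + - y ≈ 0#
  ≈⇒minus {x} {y} p = ≈-trans (+-congʳ p) (-‿inverseʳ y)

  *-cancelˡ : ∀ {x y z} → x ≉ 0# → x * y ≈ x * z → y ≈ z
  *-cancelˡ {x} {y} {z} x≉0 p = minus⇒≈ (*-cancelˡ-zero x≉0 (begin
    x * (y + - z)       ≈⟨ distribˡ x y (- z) ⟩
    x * y + x * - z     ≈⟨ +-congˡ (-‿distribʳ-* x z) ⟨
    x * y + - (x * z)   ≈⟨ ≈⇒minus p ⟩
    0#                  ∎))

  *-cancelʳ : ∀ {x y z} → z ≉ 0# → x * z ≈ y * z → x ≈ y
  *-cancelʳ {x} {y} {z} z≉0 p = minus⇒≈ (*-cancelʳ-zero z≉0 (begin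
    (x + - y) * z       ≈⟨ distribʳ z x (- y) ⟩
    x * z + - y * z     ≈⟨ +-congˡ (-‿distribˡ-* y z) ⟨
    x * z + - (y * z)   ≈⟨ ≈⇒minus p ⟩
    0#                  ∎))

  unit≉0 : ∀ {x y} → x * y ≈ 1# → x ≉ 0#
  unit≉0 {x} {y} xy x≈0 = 1≉0 (≈-trans (≈-sym xy) (≈-trans (*-congʳ x≈0) (zeroˡ y)))

  -- Below, x and y are the coefficients of a linear combination of two rows, and a, b
  -- the entries of a column on which the combination vanishes.
  equal-columns : ∀ {x y a b} → x ≉ 0# → x + y ≈ 0# → x * a + y * b ≈ 0# → a ≈ b
  equal-columns {x} {y} {a} {b} x≉0 x+y p = *-cancelˡ x≉0 (begin
    x * a          ≈⟨ opposite p ⟩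
    - (y * b)      ≈⟨ -‿distribˡ-* y b ⟩
    - y * b        ≈⟨ *-congʳ (opposite x+y) ⟨
    x * b          ∎)

  opposite-columns : ∀ {x y a b} → x ≉ 0# → x ≈ y → x * a + y * b ≈ 0# → a + b ≈ 0#
  opposite-columns {x} {y} {a} {b} x≉0 x≈y p = *-cancelˡ-zero x≉0 (begin
    x * (a + b)      ≈⟨ distribˡ x a b ⟩
    x * a + x * b    ≈⟨ +-congˡ (*-congʳ x≈y) ⟩
    x * a + y * b    ≈⟨ p ⟩
    0#               ∎)

  opposite-coefficients : ∀ {x y a b} → a ≉ 0# → a ≈ b → x * a + y * b ≈ 0# → x + y ≈ 0#
  opposite-coefficients {x} {y} {a} {b} a≉0 a≈b p = *-cancelʳ-zero a≉0 (begin
    (x + y) * a      ≈⟨ distribʳ a x y ⟩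
    x * a + y * a    ≈⟨ +-congˡ (*-congˡ a≈b) ⟩
    x * a + y * b    ≈⟨ p ⟩
    0#               ∎)

  equal-coefficients : ∀ {x y a b} → a ≉ 0# → a + b ≈ 0# → x * a + y * b ≈ 0# → x ≈ y
  equal-coefficients {x} {y} {a} {b} a≉0 a+b p = *-cancelʳ a≉0 (begin
    x * a          ≈⟨ opposite p ⟩
    - (y * b)      ≈⟨ -‿distribʳ-* y b ⟩
    y * - b        ≈⟨ *-congˡ (opposite a+b) ⟨
    y * a          ∎)

  -- The factorisation (x - 1)(x + 1) = x² - 1 holds without commutativity, and the first factor is
  -- nonzero.
  square-one : ∀ {x} → x * x ≈ 1# → x ≉ 1# → x ≈ - 1#
  square-one {x} xx x≉1 = opposite (*-cancelˡ-zero (λ p → x≉1 (minus⇒≈ p)) (begin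
    (x + - 1#) * (x + 1#)                  ≈⟨ distribˡ (x + - 1#) x 1# ⟩
    (x + - 1#) * x + (x + - 1#) * 1#       ≈⟨ +-cong (distribʳ x x (- 1#)) (*-identityʳ _) ⟩
    (x * x + - 1# * x) + (x + - 1#)        ≈⟨ +-congʳ (+-cong xx (≈-trans (≈-sym (-‿distribˡ-* 1# x)) (-‿cong (*-identityˡ x)))) ⟩
    (1# + - x) + (x + - 1#)                ≈⟨ +-assoc 1# (- x) _ ⟩
    1# + (- x + (x + - 1#))                ≈⟨ +-congˡ (+-assoc (- x) x (- 1#)) ⟨
    1# + ((- x + x) + - 1#)                ≈⟨ +-congˡ (+-congʳ (-‿inverseˡ x)) ⟩
    1# + (0# + - 1#)                       ≈⟨ +-congˡ (+-identityˡ _) ⟩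
    1# + - 1#                              ≈⟨ -‿inverseʳ 1# ⟩
    0#                                     ∎))

  no-quaternions : 1# + 1# + 1# ≈ 0# → ∀ i j → i * i ≈ - 1# → j * j ≈ - 1# → i * j ≈ - (j * i) → ⊥
  no-quaternions 3≈0 i j ii jj ij = ¬one commuting
    where
    s = i + j
    anticommute : j * i + i * j ≈ 0#
    anticommute = ≈-trans (+-congˡ ij) (-‿inverseʳ (j * i))
    ss : s * s ≈ 1#
    ss = begin
      s * s                                      ≈⟨ distribˡ s i j ⟩
      s * i + s * j                              ≈⟨ +-cong (distribʳ i i j) (distribʳ j i j) ⟩
      (i * i + j * i) + (i * j + j * j)          ≈⟨ +-assoc (i * i) (j * i) _ ⟩
      i * i + (j * i + (i * j + j * j))          ≈⟨ +-congˡ (+-assoc (j * i) (i * j) (j * j)) ⟨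
      i * i + ((j * i + i * j) + j * j)          ≈⟨ +-cong ii (+-cong anticommute jj) ⟩
      - 1# + (0# + - 1#)                         ≈⟨ +-congˡ (+-identityˡ _) ⟩
      - 1# + - 1#                                ≈⟨ -‿+-comm 1# 1# ⟩
      - (1# + 1#)                                ≈⟨ opposite (≈-trans (≈-sym (+-comm (1# + 1#) 1#)) 3≈0) ⟨
      1#                                         ∎
    -- Commuting and anticommuting together give 2 i j = 0. With 3 = 0 this leaves i j = 0, although
    -- `i` and `j` are nonzero.
    commute⇒⊥ : i * j ≈ j * i → ⊥
    commute⇒⊥ comm = 1≉0 (*-cancelˡ-zero ij≉0 (begin
      i * j * 1#                    ≈⟨ *-identityʳ _ ⟩
      i * j                         ≈⟨ +-identityʳ _ ⟨
      i * j + 0#                    ≈⟨ +-congˡ twice ⟨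
      i * j + (i * j + i * j)       ≈⟨ +-assoc _ _ _ ⟨
      i * j + i * j + i * j         ≈⟨ +-cong (+-cong (*-identityʳ _) (*-identityʳ _)) (*-identityʳ _) ⟨
      i * j * 1# + i * j * 1# + i * j * 1#  ≈⟨ +-congʳ (distribˡ (i * j) 1# 1#) ⟨
      i * j * (1# + 1#) + i * j * 1#        ≈⟨ distribˡ (i * j) (1# + 1#) 1# ⟨
      i * j * (1# + 1# + 1#)        ≈⟨ *-congˡ 3≈0 ⟩
      i * j * 0#                    ≈⟨ zeroʳ _ ⟩
      0#                            ∎))
      where
      twice : i * j + i * j ≈ 0#
      twice = ≈-trans (+-congʳ comm) anticommute
      minus-unit : ∀ {x} → x * x ≈ - 1# → x ≉ 0#
      minus-unit {x} xx x≈0 = 1≉0 (begin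
        1#        ≈⟨ -‿involutive 1# ⟨
        - - 1#    ≈⟨ -‿cong xx ⟨
        - (x * x) ≈⟨ -‿cong (≈-trans (*-congʳ x≈0) (zeroˡ x)) ⟩
        - 0#      ≈⟨ -0#≈0# ⟩
        0#        ∎)
      ij≉0 : i * j ≉ 0#
      ij≉0 p = minus-unit jj (*-cancelˡ-zero (minus-unit ii) p)
    -- As j = s - i, it commutes with `i` as soon as `s` does. This covers both values 1 and -1 of
    -- `s`; they are refuted one after the other, since equality is not decided.
    central⇒⊥ : ∀ {z} → s ≈ z → i * z ≈ z * i → ⊥
    central⇒⊥ {z} s≈z iz = commute⇒⊥ (begin
      i * j                              ≈⟨ *-congˡ j≈ ⟩
      i * (- i + z)                      ≈⟨ distribˡ i (- i) z ⟩
      i * - i + i * z                    ≈⟨ +-cong (≈-trans (≈-sym (-‿distribʳ-* i i)) (-‿distribˡ-* i i)) iz ⟩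
      - i * i + z * i                    ≈⟨ distribʳ i (- i) z ⟨
      (- i + z) * i                      ≈⟨ *-congʳ j≈ ⟨
      j * i                              ∎)
      where
      j≈ : j ≈ - i + z
      j≈ = begin
        j               ≈⟨ +-identityˡ j ⟨
        0# + j          ≈⟨ +-congʳ (-‿inverseˡ i) ⟨
        - i + i + j     ≈⟨ +-assoc (- i) i j ⟩
        - i + s         ≈⟨ +-congˡ s≈z ⟩
        - i + z         ∎
    commuting : s ≈ 1# → ⊥
    commuting s≈1 = central⇒⊥ s≈1 (≈-trans (*-identityʳ i) (≈-sym (*-identityˡ i)))
    ¬one : ¬ ¬ (s ≈ 1#)
    ¬one s≉1 = central⇒⊥ (square-one ss s≉1)
      (≈-trans (≈-sym (-‿distribʳ-* i 1#)) (≈-trans (-‿cong (≈-trans (*-identityʳ i) (≈-sym (*-identityˡ i)))) (-‿distribˡ-* 1# i)))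

-- From a representation of a direct sum to its summands

comprehension : ∀ {p n} {P : Fin n → Set p} → Decidable P → Subset n
comprehension P? = tabulate (does ∘ P?)

∈-comprehension : ∀ {p n} {P : Fin n → Set p} (P? : Decidable P) i → (i ∈ comprehension P?) ⇔ P i
∈-comprehension {P = P} P? i = mk⇔
  (λ i∈ → true⇒ (P? i) (trans (sym (Vec.lookup∘tabulate (does ∘ P?) i)) (Vec.[]=⇒lookup i∈)))
  (λ Pi → Vec.lookup⇒[]= i _ (trans (Vec.lookup∘tabulate (does ∘ P?) i) (⇒true (P? i) Pi)))
  where
  true⇒ : ∀ {p} {Q : Set p} (Q? : Dec Q) → does Q? ≡ true → Q
  true⇒ (yes q) _ = q
  ⇒true : ∀ {p} {Q : Set p} (Q? : Dec Q) → Q → does Q? ≡ true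
  ⇒true (yes _) _ = refl
  ⇒true (no ¬q) q = contradiction q ¬q

-- Only a decidable support is a `Subset`. On a finite set decidability holds up to double negation,
-- which suffices for proving ⊥.
¬¬-decidable : ∀ {p} n (P : Fin n → Set p) → ¬ ¬ Decidable P
¬¬-decidable zero P k = k λ ()
¬¬-decidable (suc n) P k = ¬¬-excluded-middle λ P0? → ¬¬-decidable n (P ∘ suc) λ P? →
  k λ { zero → P0? ; (suc i) → P? i }

-- What is kept of a representation: a chain for each cocircuit, and that B is a basis.
record Realisation {c ℓ n} (κ : Level) (R : Ring c ℓ) (M : CocircuitFamily n) (B : Fin 3 → Fin n) : Set (c ⊔ ℓ ⊔ lsuc κ) where
  open Ring R
  field
    C : (Fin n → Carrier) → Set κ
    +∈ : ∀ x y → C x → C y → C (λ i → x i + y i)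
    *∈ : ∀ r x → C x → C (λ i → r * x i)
    chain : ∀ X → M X → ∃ λ x → C x × (∀ i → i ∈ X → ¬ (x i ≈ 0#)) × (∀ i → i ∉ X → x i ≈ 0#)
    vanishing : ∀ x → C x → (∀ t → x (B t) ≈ 0#) → ∀ i → x i ≈ 0#

module Summands {c ℓ κ : Level} (F : SkewField c ℓ) {m n : ℕ} {M₁ : CocircuitFamily m} {M₂ : CocircuitFamily n}
  (representable : RepresentableOverSF κ F (M₁ ⊕ M₂))
  (B₁ : Fin 3 → Fin m) (meets₁ : ∀ X → M₁ X → ∃ λ t → B₁ t ∈ X)
  (B₂ : Fin 3 → Fin n) (meets₂ : ∀ X → M₂ X → ∃ λ t → B₂ t ∈ X)
  where

  open SkewField F using (ring)
  open ¬¬-Closure ring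
  open Ring ring using (_≈_; 0#)
  private
    module R = Ring closure
    C = proj₁ representable
    chainGroup = IsPChainGroup.chainGroup (proj₁ (proj₂ representable))
    M⇔ = proj₂ (proj₂ representable)
  open IsChainGroup chainGroup
  open Chains _≈_ 0#

  -- Every cocircuit meets its basis, and a nonzero chain whose support avoids both bases
  -- is elementary because, by induction, no such chain has a smaller support.
  no-chain : ∀ X → Acc _⊂_ X → ∀ x → C x → (∀ e → (e ∈ X) ⇔ supp x e) → NonZeroChain x →
             (∀ t → B₁ t ↑ˡ n ∉ X) → (∀ t → m ↑ʳ B₂ t ∉ X) → ⊥
  no-chain X (acc rec) x Cx X⇔ nz avoids₁ avoids₂ = meets (Equivalence.from (M⇔ X) (x , (Cx , nz , minimal) , X⇔))
    where
    meets : ¬ (M₁ ⊕ M₂) X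
    meets (inj₁ (Y , refl , M₁Y)) = let t , t∈ = meets₁ Y M₁Y in avoids₁ t (Equivalence.from (∈-++ˡ Y ∅ (B₁ t)) t∈)
    meets (inj₂ (Z , refl , M₂Z)) = let t , t∈ = meets₂ Z M₂Z in avoids₂ t (Equivalence.from (∈-++ʳ (∅ {m}) Z (B₂ t)) t∈)
    minimal : ∀ y → C y → ¬ (NonZeroChain y × StrictSubsupport y x)
    minimal y Cy (nz-y , sub , e , xe , ¬ye) = ¬¬-decidable _ (supp y) λ supp? →
      let Y⇔ = ∈-comprehension supp?
          Y⊆X : ∀ {e} → e ∈ comprehension supp? → e ∈ X
          Y⊆X {e} e∈Y = Equivalence.from (X⇔ e) (sub e (Equivalence.to (Y⇔ e) e∈Y))
      in no-chain (comprehension supp?)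
           (rec (Y⊆X , e , Equivalence.from (X⇔ e) xe , λ e∈Y → ¬ye (Equivalence.to (Y⇔ e) e∈Y)))
           y Cy Y⇔ nz-y (λ t t∈ → avoids₁ t (Y⊆X t∈)) (λ t t∈ → avoids₂ t (Y⊆X t∈))

  vanishing-on-bases : ∀ x → C x → (∀ t → x (B₁ t ↑ˡ n) ≈¬¬ 0#) → (∀ t → x (m ↑ʳ B₂ t) ≈¬¬ 0#) → ∀ e → x e ≈¬¬ 0#
  vanishing-on-bases x Cx z₁ z₂ e xe = ¬¬-decidable _ (supp x) λ supp? →
    let X⇔ = ∈-comprehension supp? in
    no-chain (comprehension supp?) (⊂-wellFounded _) x Cx X⇔ (e , xe)
      (λ t t∈ → z₁ t (Equivalence.to (X⇔ _) t∈)) (λ t t∈ → z₂ t (Equivalence.to (X⇔ _) t∈))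

  zero+ : ∀ {x y} → x ≈¬¬ 0# → y ≈¬¬ 0# → (x R.+ y) ≈¬¬ 0#
  zero+ p q = R.trans (R.+-cong p q) (R.+-identityˡ 0#)

  zero* : ∀ r {x} → x ≈¬¬ 0# → (r R.* x) ≈¬¬ 0#
  zero* r p = R.trans (R.*-congˡ p) (R.zeroʳ r)

  -- The chains taken are those that extend by zero to the other summand. Their extensions vanish on
  -- `B₂`, so vanishing on `B₁` already makes them zero.
  realisation₁ : Realisation (c ⊔ ℓ ⊔ κ) closure M₁ B₁
  realisation₁ = record
    { C = λ x → ∃ λ z → C z × (∀ i → z (i ↑ˡ n) ≈¬¬ x i) × (∀ j → z (m ↑ʳ j) ≈¬¬ 0#)
    ; +∈ = λ { x y (z , Cz , z≈x , z≈0) (w , Cw , w≈y , w≈0) → _ , +-closed z w Cz Cw ,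
        (λ i → R.+-cong (z≈x i) (w≈y i)) , (λ j → zero+ (z≈0 j) (w≈0 j)) }
    ; *∈ = λ { r x (z , Cz , z≈x , z≈0) → _ , *-closed r z Cz , (λ i → R.*-congˡ (z≈x i)) , (λ j → zero* r (z≈0 j)) }
    ; chain = λ X M₁X → let z , (Cz , _) , X⇔ = Equivalence.to (M⇔ (X ++ ∅)) (inj₁ (X , refl , M₁X)) in
        (λ i → z (i ↑ˡ n)) ,
        (z , Cz , (λ i → R.refl) , (λ j zj → ∉⊥ (Equivalence.to (∈-++ʳ X ∅ j) (Equivalence.from (X⇔ (m ↑ʳ j)) zj)))) ,
        (λ i i∈ zi → zi (Equivalence.to (X⇔ (i ↑ˡ n)) (Equivalence.from (∈-++ˡ X ∅ i) i∈))) ,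
        (λ i i∉ zi → i∉ (Equivalence.to (∈-++ˡ X ∅ i) (Equivalence.from (X⇔ (i ↑ˡ n)) zi)))
    ; vanishing = λ { x (z , Cz , z≈x , z≈0) x≈0 i → R.trans (R.sym (z≈x i))
        (vanishing-on-bases z Cz (λ t → R.trans (z≈x (B₁ t)) (x≈0 t)) (λ t → z≈0 (B₂ t)) (i ↑ˡ n)) }
    }

  realisation₂ : Realisation (c ⊔ ℓ ⊔ κ) closure M₂ B₂
  realisation₂ = record
    { C = λ x → ∃ λ z → C z × (∀ j → z (m ↑ʳ j) ≈¬¬ x j) × (∀ i → z (i ↑ˡ n) ≈¬¬ 0#)
    ; +∈ = λ { x y (z , Cz , z≈x , z≈0) (w , Cw , w≈y , w≈0) → _ , +-closed z w Cz Cw ,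
        (λ i → R.+-cong (z≈x i) (w≈y i)) , (λ j → zero+ (z≈0 j) (w≈0 j)) }
    ; *∈ = λ { r x (z , Cz , z≈x , z≈0) → _ , *-closed r z Cz , (λ i → R.*-congˡ (z≈x i)) , (λ j → zero* r (z≈0 j)) }
    ; chain = λ X M₂X → let z , (Cz , _) , X⇔ = Equivalence.to (M⇔ (∅ {m} ++ X)) (inj₂ (X , refl , M₂X)) in
        (λ j → z (m ↑ʳ j)) ,
        (z , Cz , (λ j → R.refl) , (λ i zi → ∉⊥ (Equivalence.to (∈-++ˡ ∅ X i) (Equivalence.from (X⇔ (i ↑ˡ n)) zi)))) ,
        (λ j j∈ zj → zj (Equivalence.to (X⇔ (m ↑ʳ j)) (Equivalence.from (∈-++ʳ (∅ {m}) X j) j∈))) ,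
        (λ j j∉ zj → j∉ (Equivalence.to (∈-++ʳ (∅ {m}) X j) (Equivalence.from (X⇔ (m ↑ʳ j)) zj)))
    ; vanishing = λ { x (z , Cz , z≈x , z≈0) x≈0 j → R.trans (R.sym (z≈x j))
        (vanishing-on-bases z Cz (λ t → z≈0 (B₁ t)) (λ t → R.trans (z≈x (B₂ t)) (x≈0 t)) (m ↑ʳ j)) }
    }

-- The chains `f` serve as the rows of a matrix that is diagonal on `B`. Any chain is the
-- combination of them that agrees with it on `B`, because the difference vanishes there.
module Expansion {c ℓ κ n} {R : Ring c ℓ} (isSkew : IsSkewField R) {M : CocircuitFamily n} {B : Fin 3 → Fin n}
  (realisation : Realisation κ R M B)
  (f : Fin 3 → Fin n → Ring.Carrier R)
  (f∈ : ∀ t → Realisation.C realisation (f t))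
  (diagonal : ∀ t → ¬ Ring._≈_ R (f t (B t)) (Ring.0# R)) (off-diagonal : ∀ t u → t ≢ u → Ring._≈_ R (f t (B u)) (Ring.0# R))
  where

  open SkewFieldArithmetic R isSkew
  open Realisation realisation
  open RingProperties R using (-‿distribˡ-*)

  coefficient : (Fin n → Carrier) → Fin 3 → Carrier
  coefficient x t = x (B t) * proj₁ (inverse (f t (B t)) (diagonal t))

  coefficient-zero : ∀ x t → x (B t) ≈ 0# → coefficient x t ≈ 0#
  coefficient-zero x t x≈0 = ≈-trans (*-congʳ x≈0) (zeroˡ _)

  coefficient-nonzero : ∀ x t → ¬ (x (B t) ≈ 0#) → ¬ (coefficient x t ≈ 0#)
  coefficient-nonzero x t x≉0 p = x≉0 (*-cancelʳ-zero (unit≉0 (proj₂ (proj₂ (inverse (f t (B t)) (diagonal t))))) p)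

  term : (Fin n → Carrier) → Fin 3 → Fin n → Carrier
  term x t i = coefficient x t * f t i

  combination : (Fin n → Carrier) → Fin n → Carrier
  combination x i = term x (# 0) i + term x (# 1) i + term x (# 2) i

  term-diagonal : ∀ x t → term x t (B t) ≈ x (B t)
  term-diagonal x t = ≈-trans (*-assoc _ _ _) (≈-trans (*-congˡ (proj₂ (proj₂ (inverse (f t (B t)) (diagonal t))))) (*-identityʳ _))

  term-off : ∀ x t u → t ≢ u → term x t (B u) ≈ 0#
  term-off x t u t≢u = ≈-trans (*-congˡ (off-diagonal t u t≢u)) (zeroʳ _)

  drop₀ : ∀ {a b c} → a ≈ 0# → a + b + c ≈ b + c
  drop₀ a≈0 = +-congʳ (≈-trans (+-congʳ a≈0) (+-identityˡ _))

  drop₁ : ∀ {a b c} → b ≈ 0# → a + b + c ≈ a + c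
  drop₁ b≈0 = +-congʳ (≈-trans (+-congˡ b≈0) (+-identityʳ _))

  drop₂ : ∀ {a b c} → c ≈ 0# → a + b + c ≈ a + b
  drop₂ c≈0 = ≈-trans (+-congˡ c≈0) (+-identityʳ _)

  combination-B : ∀ x t → combination x (B t) ≈ x (B t)
  combination-B x zero = ≈-trans (drop₂ (term-off x _ _ λ ())) (≈-trans (+-congˡ (term-off x _ _ λ ())) (≈-trans (+-identityʳ _) (term-diagonal x _)))
  combination-B x (suc zero) = ≈-trans (drop₂ (term-off x _ _ λ ())) (≈-trans (+-congʳ (term-off x _ _ λ ())) (≈-trans (+-identityˡ _) (term-diagonal x _)))
  combination-B x (suc (suc zero)) = ≈-trans (drop₁ (term-off x _ _ λ ())) (≈-trans (+-congʳ (term-off x _ _ λ ())) (≈-trans (+-identityˡ _) (term-diagonal x _)))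

  expand : ∀ x → C x → ∀ i → x i ≈ combination x i
  expand x Cx i = minus⇒≈ (≈-trans (+-congˡ (≈-sym (minus-one-* _))) (vanishing z z∈ z≈0 i))
    where
    minus-one-* : ∀ a → - 1# * a ≈ - a
    minus-one-* a = ≈-trans (≈-sym (-‿distribˡ-* 1# a)) (-‿cong (*-identityˡ a))
    z : Fin n → Carrier
    z i = x i + - 1# * combination x i
    z∈ : C z
    z∈ = +∈ _ _ Cx (*∈ _ _ (+∈ _ _ (+∈ _ _ (*∈ _ _ (f∈ (# 0))) (*∈ _ _ (f∈ (# 1)))) (*∈ _ _ (f∈ (# 2)))))
    z≈0 : ∀ t → z (B t) ≈ 0#
    z≈0 t = ≈-trans (+-congˡ (minus-one-* _)) (≈⇒minus (≈-sym (combination-B x t)))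

  -- A column on which the chain is zero and one term drops out relates the other two terms. This
  -- turns a point of a hyperplane into an equation in the skew field.
  relation₀₁ : ∀ x → C x → ∀ i → x i ≈ 0# → term x (# 2) i ≈ 0# → term x (# 0) i + term x (# 1) i ≈ 0#
  relation₀₁ x Cx i x≈0 p = ≈-trans (≈-sym (drop₂ p)) (≈-trans (≈-sym (expand x Cx i)) x≈0)

  relation₀₂ : ∀ x → C x → ∀ i → x i ≈ 0# → term x (# 1) i ≈ 0# → term x (# 0) i + term x (# 2) i ≈ 0#
  relation₀₂ x Cx i x≈0 p = ≈-trans (≈-sym (drop₁ p)) (≈-trans (≈-sym (expand x Cx i)) x≈0)

  relation₁₂ : ∀ x → C x → ∀ i → x i ≈ 0# → term x (# 0) i ≈ 0# → term x (# 1) i + term x (# 2) i ≈ 0#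
  relation₁₂ x Cx i x≈0 p = ≈-trans (≈-sym (drop₀ p)) (≈-trans (≈-sym (expand x Cx i)) x≈0)

  term-coefficient-zero : ∀ x t i → x (B t) ≈ 0# → term x t i ≈ 0#
  term-coefficient-zero x t i p = ≈-trans (*-congʳ (coefficient-zero x t p)) (zeroˡ _)

  term-chain-zero : ∀ x t i → f t i ≈ 0# → term x t i ≈ 0#
  term-chain-zero x t i p = ≈-trans (*-congˡ p) (zeroʳ _)

-- R₉ forces characteristic 3

R₉-row : 𝔽₃ → 𝔽₃ → 𝔽₃ → Fin 9 → 𝔽₃
R₉-row a b c i = (a *₃ R₉-matrix (# 0) i) +₃ ((b *₃ R₉-matrix (# 1) i) +₃ ((c *₃ R₉-matrix (# 2) i) +₃ z₃))

R₉-basis : Fin 3 → Fin 9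
R₉-basis t = t ↑ˡ 6

R₉-meets : ∀ X → R₉ X → ∃ λ t → R₉-basis t ∈ X
R₉-meets X (x , ((y , x≡) , (i , xi) , _) , X⇔) =
  let t , xt = nonzero (y (# 0)) (y (# 1)) (y (# 2)) i (λ eq → xi (trans (x≡ i) eq))
  in t , Equivalence.from (X⇔ _) (λ eq → xt (trans (sym (x≡ _)) eq))
  where
  nonzero : ∀ a b c i → R₉-row a b c i ≢ z₃ → ∃ λ t → R₉-row a b c (R₉-basis t) ≢ z₃
  nonzero = from-yes (all₃? λ a → all₃? λ b → all₃? λ c → Fin.all? λ i →
    ¬? (R₉-row a b c i ≟₃ z₃) →-dec Fin.any? λ t → ¬? (R₉-row a b c (R₉-basis t) ≟₃ z₃))

open DecidableChains _≟₃_ z₃ using (NonZeroChain; StrictSubsupport)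

-- Elementarity with the quantifier over chains replaced by one over the 27 coefficient triples, so
-- that computation decides it.
Minimal : 𝔽₃ → 𝔽₃ → 𝔽₃ → Set
Minimal a b c = NonZeroChain (R₉-row a b c) ×
  (∀ a′ b′ c′ → ¬ (NonZeroChain (R₉-row a′ b′ c′) × StrictSubsupport (R₉-row a′ b′ c′) (R₉-row a b c)))

minimal? : ∀ a b c → Dec (Minimal a b c)
minimal? a b c = nonzero? (R₉-row a b c) ×-dec (all₃? λ a′ → all₃? λ b′ → all₃? λ c′ →
  ¬? (nonzero? (R₉-row a′ b′ c′) ×-dec
    ((Fin.all? λ i → supp? (R₉-row a′ b′ c′) i →-dec supp? (R₉-row a b c) i) ×-dec
     (Fin.any? λ i → supp? (R₉-row a b c) i ×-dec ¬? (supp? (R₉-row a′ b′ c′) i)))))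
  where
  open DecidableChains _≟₃_ z₃ using (nonzero?; Chain; supp)
  supp? : ∀ {n} (x : Chain n) i → Dec (supp x i)
  supp? x i = ¬? (x i ≟₃ z₃)

module _ (a b c : 𝔽₃) where

  R₉-support : Subset 9
  R₉-support = comprehension (λ i → ¬? (R₉-row a b c i ≟₃ z₃))

  R₉-support-cocircuit : Minimal a b c → R₉ R₉-support
  R₉-support-cocircuit (nz , minimal) =
    R₉-row a b c , (((λ { zero → a ; (suc zero) → b ; (suc (suc zero)) → c }) , λ i → refl) , nz , λ where
      x (y , x≡) (nz-x , sub , i , ci , ¬xi) → minimal (y (# 0)) (y (# 1)) (y (# 2))
        ( (proj₁ nz-x , λ eq → proj₂ nz-x (trans (x≡ _) eq))
        , (λ i yi → sub i (λ eq → yi (trans (sym (x≡ i)) eq)))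
        , i , ci , λ yi → ¬xi (λ eq → yi (trans (sym (x≡ i)) eq)) ))
    , ∈-comprehension (λ i → ¬? (R₉-row a b c i ≟₃ z₃))

module R₉-characteristic {c₀ ℓ κ} {R : Ring c₀ ℓ} (isSkew : IsSkewField R) (realisation : Realisation κ R R₉ R₉-basis) where

  open SkewFieldArithmetic R isSkew
  open Realisation realisation

  record Hyperplane (a b c : 𝔽₃) : Set (c₀ ⊔ ℓ ⊔ κ) where
    field
      x : Fin 9 → Carrier
      x∈ : C x
      nonzero : ∀ i → R₉-row a b c i ≢ z₃ → x i ≉ 0#
      zeros : ∀ i → R₉-row a b c i ≡ z₃ → x i ≈ 0#
  open Hyperplane

  hyperplane : ∀ a b c → {True (minimal? a b c)} → Hyperplane a b c
  hyperplane a b c {minimal} =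
    let x , x∈ , nonzero , zeros = chain (R₉-support a b c) (R₉-support-cocircuit a b c (toWitness minimal)) in record
    { x = x
    ; x∈ = x∈
    ; nonzero = λ i p → nonzero i (Equivalence.from (∈-support i) p)
    ; zeros = λ i p → zeros i (λ i∈ → Equivalence.to (∈-support i) i∈ p)
    }
    where
    ∈-support = ∈-comprehension (λ i → ¬? (R₉-row a b c i ≟₃ z₃))

  δ : Fin 3 → Fin 3 → 𝔽₃
  δ t u = if does (t Fin.≟ u) then o₃ else z₃

  coordinateHyperplane : ∀ t → Hyperplane (δ t (# 0)) (δ t (# 1)) (δ t (# 2))
  coordinateHyperplane zero = hyperplane o₃ z₃ z₃
  coordinateHyperplane (suc zero) = hyperplane z₃ o₃ z₃
  coordinateHyperplane (suc (suc zero)) = hyperplane z₃ z₃ o₃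

  row : Fin 3 → Fin 9 → 𝔽₃
  row t = R₉-row (δ t (# 0)) (δ t (# 1)) (δ t (# 2))

  at-3 : ∀ t → x (coordinateHyperplane t) (# 3) ≉ 0#
  at-3 t = nonzero (coordinateHyperplane t) (# 3) (row-3 t)
    where
    row-3 : ∀ t → row t (# 3) ≢ z₃
    row-3 = from-yes (Fin.all? λ t → ¬? (row t (# 3) ≟₃ z₃))

  -- Scaled so that the column (1,1,1) is represented by (1,1,1).
  f : Fin 3 → Fin 9 → Carrier
  f t i = proj₁ (inverse _ (at-3 t)) * x (coordinateHyperplane t) i

  f-one : ∀ t → f t (# 3) ≈ 1#
  f-one t = proj₂ (proj₂ (inverse _ (at-3 t)))

  f-zero : ∀ t i → row t i ≡ z₃ → f t i ≈ 0#
  f-zero t i p = ≈-trans (*-congˡ (zeros (coordinateHyperplane t) i p)) (zeroʳ _)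

  f-nonzero : ∀ t i → row t i ≢ z₃ → f t i ≉ 0#
  f-nonzero t i p q = nonzero (coordinateHyperplane t) i p (*-cancelˡ-zero (unit≉0 (proj₂ (proj₂ (inverse _ (at-3 t))))) q)

  row-diagonal : ∀ t → row t (R₉-basis t) ≢ z₃
  row-diagonal = from-yes (Fin.all? λ t → ¬? (row t (R₉-basis t) ≟₃ z₃))

  row-off-diagonal : ∀ t u → t ≢ u → row t (R₉-basis u) ≡ z₃
  row-off-diagonal = from-yes (Fin.all? λ t → Fin.all? λ u → ¬? (t Fin.≟ u) →-dec (row t (R₉-basis u) ≟₃ z₃))

  open Expansion isSkew realisation f (λ t → *∈ _ _ (x∈ (coordinateHyperplane t)))
    (λ t → f-nonzero t _ (row-diagonal t)) (λ t u t≢u → f-zero t _ (row-off-diagonal t u t≢u))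

  f-same-3 : ∀ t u → f t (# 3) ≈ f u (# 3)
  f-same-3 t u = ≈-trans (f-one t) (≈-sym (f-one u))

  -- Column (1,1,0), from the line through (0,0,1), (1,1,1), (1,1,0).
  column-4 : f (# 0) (# 4) ≈ f (# 1) (# 4)
  column-4 = equal-columns (coefficient-nonzero (x X) (# 0) (nonzero X _ λ ()))
    (opposite-coefficients (f-nonzero (# 0) (# 3) λ ()) (f-same-3 (# 0) (# 1))
      (relation₀₁ (x X) (x∈ X) (# 3) (zeros X _ refl) (term-coefficient-zero (x X) _ _ (zeros X _ refl))))
    (relation₀₁ (x X) (x∈ X) (# 4) (zeros X _ refl) (term-coefficient-zero (x X) _ _ (zeros X _ refl)))
    where X = hyperplane o₃ t₃ z₃

  -- Column (0,1,1), from the line through (1,0,0), (1,1,1), (0,1,1).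
  column-6 : f (# 1) (# 6) ≈ f (# 2) (# 6)
  column-6 = equal-columns (coefficient-nonzero (x X) (# 1) (nonzero X _ λ ()))
    (opposite-coefficients (f-nonzero (# 1) (# 3) λ ()) (f-same-3 (# 1) (# 2))
      (relation₁₂ (x X) (x∈ X) (# 3) (zeros X _ refl) (term-coefficient-zero (x X) _ _ (zeros X _ refl))))
    (relation₁₂ (x X) (x∈ X) (# 6) (zeros X _ refl) (term-coefficient-zero (x X) _ _ (zeros X _ refl)))
    where X = hyperplane z₃ o₃ t₃

  -- Column (1,0,1), from the line through (0,1,0), (1,1,1), (1,0,1).
  column-8 : f (# 0) (# 8) ≈ f (# 2) (# 8)
  column-8 = equal-columns (coefficient-nonzero (x X) (# 0) (nonzero X _ λ ()))
    (opposite-coefficients (f-nonzero (# 0) (# 3) λ ()) (f-same-3 (# 0) (# 2))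
      (relation₀₂ (x X) (x∈ X) (# 3) (zeros X _ refl) (term-coefficient-zero (x X) _ _ (zeros X _ refl))))
    (relation₀₂ (x X) (x∈ X) (# 8) (zeros X _ refl) (term-coefficient-zero (x X) _ _ (zeros X _ refl)))
    where X = hyperplane o₃ z₃ t₃

  same : ∀ {a b c} → a + c ≈ 0# → b + c ≈ 0# → a ≈ b
  same p q = ≈-trans (opposite p) (≈-sym (opposite q))

  -- Column (1,2,0), from the line through (0,1,1), (1,0,1), (1,2,0).
  column-5 : f (# 0) (# 5) + f (# 1) (# 5) ≈ 0#
  column-5 = opposite-columns (coefficient-nonzero (x X) (# 0) (nonzero X _ λ ()))
    (same
      (opposite-coefficients (f-nonzero (# 0) (# 8) λ ()) column-8
        (relation₀₂ (x X) (x∈ X) (# 8) (zeros X _ refl) (term-chain-zero (x X) _ _ (f-zero (# 1) _ refl))))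
      (opposite-coefficients (f-nonzero (# 1) (# 6) λ ()) column-6
        (relation₁₂ (x X) (x∈ X) (# 6) (zeros X _ refl) (term-chain-zero (x X) _ _ (f-zero (# 0) _ refl)))))
    (relation₀₁ (x X) (x∈ X) (# 5) (zeros X _ refl) (term-chain-zero (x X) _ _ (f-zero (# 2) _ refl)))
    where X = hyperplane o₃ o₃ t₃

  -- Column (0,1,2), from the line through (1,1,0), (1,0,1), (0,1,2).
  column-7 : f (# 1) (# 7) + f (# 2) (# 7) ≈ 0#
  column-7 = opposite-columns (coefficient-nonzero (x X) (# 1) (nonzero X _ λ ()))
    (same
      (≈-trans (+-comm _ _) (opposite-coefficients (f-nonzero (# 0) (# 4) λ ()) column-4
        (relation₀₁ (x X) (x∈ X) (# 4) (zeros X _ refl) (term-chain-zero (x X) _ _ (f-zero (# 2) _ refl)))))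
      (≈-trans (+-comm _ _) (opposite-coefficients (f-nonzero (# 0) (# 8) λ ()) column-8
        (relation₀₂ (x X) (x∈ X) (# 8) (zeros X _ refl) (term-chain-zero (x X) _ _ (f-zero (# 1) _ refl))))))
    (relation₁₂ (x X) (x∈ X) (# 7) (zeros X _ refl) (term-chain-zero (x X) _ _ (f-zero (# 0) _ refl)))
    where X = hyperplane t₃ o₃ o₃

  -- The points (1,1,1), (1,2,0), (0,1,2) are collinear only in characteristic 3.
  characteristic-3 : 1# + 1# + 1# ≈ 0#
  characteristic-3 = *-cancelˡ-zero (coefficient-nonzero (x X) (# 0) (nonzero X _ λ ())) (begin
    y₀ * (1# + 1# + 1#)          ≈⟨ distribˡ y₀ (1# + 1#) 1# ⟩
    y₀ * (1# + 1#) + y₀ * 1#     ≈⟨ +-congʳ (distribˡ y₀ 1# 1#) ⟩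
    y₀ * 1# + y₀ * 1# + y₀ * 1#  ≈⟨ +-cong (+-cong (*-congˡ (≈-sym (f-one (# 0)))) (*-cong y₀≈y₁ (≈-sym (f-one (# 1)))))
                                           (*-cong (≈-trans y₀≈y₁ y₁≈y₂) (≈-sym (f-one (# 2)))) ⟩
    combination (x X) (# 3)      ≈⟨ expand (x X) (x∈ X) (# 3) ⟨
    x X (# 3)                    ≈⟨ zeros X (# 3) refl ⟩
    0#                           ∎)
    where
    open SetoidReasoning setoid
    X = hyperplane o₃ o₃ o₃
    y₀ = coefficient (x X) (# 0)
    y₀≈y₁ : y₀ ≈ coefficient (x X) (# 1)
    y₀≈y₁ = equal-coefficients (f-nonzero (# 0) (# 5) λ ()) column-5
      (relation₀₁ (x X) (x∈ X) (# 5) (zeros X _ refl) (term-chain-zero (x X) _ _ (f-zero (# 2) _ refl)))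
    y₁≈y₂ : coefficient (x X) (# 1) ≈ coefficient (x X) (# 2)
    y₁≈y₂ = equal-coefficients (f-nonzero (# 1) (# 7) λ ()) column-7
      (relation₁₂ (x X) (x∈ X) (# 7) (zeros X _ refl) (term-chain-zero (x X) _ _ (f-zero (# 0) _ refl)))

-- Q₃(G) forces a copy of the quaternion group

Q₃-basis : Fin 3 → Fin 27
Q₃-basis t = index (joint t)

Q₃-meets : ∀ X → Q₃G X → ∃ λ t → Q₃-basis t ∈ X
Q₃-meets X X∈ =
  let l , X⇔ = Equivalence.to (Q₃-cocircuit X) X∈
      t , l-t = covector-nonzero l
  in t , Equivalence.from (X⇔ (Q₃-basis t)) (λ z → l-t (subst (Zero (covector l)) (point-index (joint t)) z))

module Q₃-homomorphism {c ℓ κ} {R : Ring c ℓ} (isSkew : IsSkewField R) (realisation : Realisation κ R Q₃G Q₃-basis) where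

  open SkewFieldArithmetic R isSkew
  open Realisation realisation
  open SetoidReasoning setoid
  open RingProperties R using (-‿distribˡ-*; -‿distribʳ-*)

  line-chain : ∀ l → ∃ λ x → C x × (∀ p → ¬ Zero (covector l) p → x (index p) ≉ 0#) × (∀ p → Zero (covector l) p → x (index p) ≈ 0#)
  line-chain l =
    let x , x∈ , nonzero , zeros = chain X (Equivalence.from (Q₃-cocircuit X) (l , X⇔)) in
    x , x∈ ,
    (λ p ¬z → nonzero (index p) (Equivalence.from (X⇔ (index p)) (λ z → ¬z (subst (Zero (covector l)) (point-index p) z)))) ,
    (λ p z → zeros (index p) (λ p∈ → Equivalence.to (X⇔ (index p)) p∈ (subst (Zero (covector l)) (sym (point-index p)) z)))
    where
    off? = λ i → ¬? (zero? (covector l) (point i))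
    X = comprehension off?
    X⇔ = ∈-comprehension off?

  x : Line → Fin 27 → Carrier
  x l = proj₁ (line-chain l)

  x∈ : ∀ l → C (x l)
  x∈ l = proj₁ (proj₂ (line-chain l))

  nonzero : ∀ l p → ¬ Zero (covector l) p → x l (index p) ≉ 0#
  nonzero l = proj₁ (proj₂ (proj₂ (line-chain l)))

  zeros : ∀ l p → Zero (covector l) p → x l (index p) ≈ 0#
  zeros l = proj₂ (proj₂ (proj₂ (line-chain l)))

  f : Fin 3 → Fin 27 → Carrier
  f t = x (side t)

  side-diagonal : ∀ t → ¬ Zero (covector (side t)) (joint t)
  side-diagonal = from-yes (Fin.all? λ t → ¬? (zero? (covector (side t)) (joint t)))

  side-off-diagonal : ∀ t u → t ≢ u → Zero (covector (side t)) (joint u)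
  side-off-diagonal = from-yes (Fin.all? λ t → Fin.all? λ u → ¬? (t Fin.≟ u) →-dec zero? (covector (side t)) (joint u))

  open Expansion isSkew realisation f (λ t → x∈ (side t))
    (λ t → nonzero (side t) (joint t) (side-diagonal t))
    (λ t u t≢u → zeros (side t) (joint u) (side-off-diagonal t u t≢u))

  f-on : ∀ t m → f t (index (on t m)) ≉ 0#
  f-on t m = nonzero (side t) (on t m) (side-on t m)
    where
    side-on : ∀ t m → ¬ Zero (covector (side t)) (on t m)
    side-on = from-yes (Fin.all? λ t → Fin.all? λ m → ¬? (zero? (covector (side t)) (on t m)))

  f-on₂ : ∀ t m → f (σ (σ t)) (index (on t m)) ≈ 0#
  f-on₂ t m = zeros (side (σ (σ t))) (on t m) (side-on t m)
    where
    side-on : ∀ t m → Zero (covector (side (σ (σ t)))) (on t m)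
    side-on = from-yes (Fin.all? λ t → Fin.all? λ m → zero? (covector (side (σ (σ t)))) (on t m))

  expand-on : ∀ z → C z → ∀ t m → z (index (on t m)) ≈ term z t (index (on t m)) + term z (σ t) (index (on t m))
  expand-on z z∈ zero m = ≈-trans (expand z z∈ _) (drop₂ (term-chain-zero z _ _ (f-on₂ (# 0) m)))
  expand-on z z∈ (suc zero) m = ≈-trans (expand z z∈ _) (drop₀ (term-chain-zero z _ _ (f-on₂ (# 1) m)))
  -- The successor of 2 is 0, so the two remaining terms come in the opposite order.
  expand-on z z∈ (suc (suc zero)) m = ≈-trans (expand z z∈ _) (≈-trans (drop₁ (term-chain-zero z _ _ (f-on₂ (# 2) m))) (+-comm _ _))

  f⁻¹ : Fin 3 → Q₈ → Carrier
  f⁻¹ t m = proj₁ (inverse _ (f-on t m))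

  -- Up to a right factor, the point on t m is the column with -1 in row t and α t m in
  -- row t + 1, as for q m in the given representation.
  α : Fin 3 → Q₈ → Carrier
  α t m = - (f (σ t) (index (on t m)) * f⁻¹ t m)

  α-f : ∀ t m → α t m * f t (index (on t m)) ≈ - f (σ t) (index (on t m))
  α-f t m = begin
    - (b * a⁻¹) * a    ≈⟨ -‿distribˡ-* (b * a⁻¹) a ⟨
    - (b * a⁻¹ * a)    ≈⟨ -‿cong (*-assoc b a⁻¹ a) ⟩
    - (b * (a⁻¹ * a))  ≈⟨ -‿cong (*-congˡ (proj₂ (proj₂ (inverse _ (f-on t m))))) ⟩
    - (b * 1#)         ≈⟨ -‿cong (*-identityʳ b) ⟩
    - b                ∎
    where
    a = f t (index (on t m))
    a⁻¹ = f⁻¹ t m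
    b = f (σ t) (index (on t m))

  coefficient-α : ∀ z t m → coefficient z (σ t) * α t m * f t (index (on t m)) ≈ - term z (σ t) (index (on t m))
  coefficient-α z t m = ≈-trans (*-assoc _ _ _) (≈-trans (*-congˡ (α-f t m)) (≈-sym (-‿distribʳ-* _ _)))

  vanishes⇒α : ∀ z → C z → ∀ t m → z (index (on t m)) ≈ 0# → coefficient z t ≈ coefficient z (σ t) * α t m
  vanishes⇒α z z∈ t m z≈0 = *-cancelʳ (f-on t m)
    (≈-trans (opposite (≈-trans (≈-sym (expand-on z z∈ t m)) z≈0)) (≈-sym (coefficient-α z t m)))

  α⇒vanishes : ∀ z → C z → ∀ t m → coefficient z t ≈ coefficient z (σ t) * α t m → z (index (on t m)) ≈ 0#
  α⇒vanishes z z∈ t m p = ≈-trans (expand-on z z∈ t m)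
    (≈-trans (+-congʳ (≈-trans (*-congʳ p) (coefficient-α z t m))) (-‿inverseˡ _))

  -- The transversal through `on (# 0) m` and `on (# 1) n` meets the third side in the point of the
  -- inverse of `n · m`. Going once round the triangle multiplies the coefficient of row 0 on the
  -- right by this product.
  α-product : ∀ m n → α (# 2) ((n · m) ⁻¹₈) * (α (# 1) n * α (# 0) m) ≈ 1#
  α-product m n = ≈-sym (*-cancelˡ (coefficient-nonzero (x l) (# 0) (nonzero l (joint (# 0)) λ ())) (begin
    y (# 0) * 1#                              ≈⟨ *-identityʳ _ ⟩
    y (# 0)                                   ≈⟨ vanishes⇒α (x l) (x∈ l) (# 0) m (zeros l (on (# 0) m) refl) ⟩
    y (# 1) * α₀                              ≈⟨ *-congʳ (vanishes⇒α (x l) (x∈ l) (# 1) n (zeros l (on (# 1) n) (cong just (sym (·-identityˡ n))))) ⟩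
    y (# 2) * α₁ * α₀                         ≈⟨ *-congʳ (*-congʳ (vanishes⇒α (x l) (x∈ l) (# 2) ((n · m) ⁻¹₈)
                                                    (zeros l (on (# 2) ((n · m) ⁻¹₈)) (cong just (sym (·-inverseʳ (n · m))))))) ⟩
    y (# 0) * α₂ * α₁ * α₀                    ≈⟨ *-assoc _ α₁ α₀ ⟩
    y (# 0) * α₂ * (α₁ * α₀)                  ≈⟨ *-assoc _ α₂ _ ⟩
    y (# 0) * (α₂ * (α₁ * α₀))                ∎))
    where
    l = transversal (# 0) m n
    y = coefficient (x l)
    α₀ = α (# 0) m
    α₁ = α (# 1) n
    α₂ = α (# 2) ((n · m) ⁻¹₈)

  α-unit : ∀ m → α (# 0) m ≉ 0#
  α-unit m p = 1≉0 (≈-trans (≈-sym (α-product m 1₈)) (≈-trans (*-congˡ (≈-trans (*-congˡ p) (zeroʳ _))) (zeroʳ _)))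

  α₁-unit : α (# 1) 1₈ ≉ 0#
  α₁-unit p = 1≉0 (≈-trans (≈-sym (α-product 1₈ 1₈)) (≈-trans (*-congˡ (≈-trans (*-congʳ p) (zeroˡ _))) (zeroʳ _)))

  -- In `α-product` the factor from side 2 depends on `n · m` alone, hence so does the product of
  -- the other two.
  α-mul : ∀ n m → α (# 1) n * α (# 0) m ≈ α (# 1) 1₈ * α (# 0) (n · m)
  α-mul n m = *-cancelˡ (unit≉0 (α-product m n))
    (≈-trans (α-product m n) (≈-sym (≈-trans (*-congʳ (reflexive (cong (λ k → α (# 2) (k ⁻¹₈)) (sym (·-identityˡ (n · m)))))) (α-product (n · m) 1₈))))

  φ : Q₈ → Carrier
  φ m = proj₁ (inverse _ (α-unit 1₈)) * α (# 0) m

  α₁φ : ∀ m → α (# 0) 1₈ * φ m ≈ α (# 0) m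
  α₁φ m = ≈-trans (≈-sym (*-assoc _ _ _)) (≈-trans (*-congʳ (proj₁ (proj₂ (inverse _ (α-unit 1₈))))) (*-identityˡ _))

  φ-one : φ 1₈ ≈ 1#
  φ-one = proj₂ (proj₂ (inverse _ (α-unit 1₈)))

  -- By `α-mul` with second argument 1, α₁ n = β α₀(n) α₀(1)⁻¹. Substituting this in `α-mul` and
  -- cancelling β shows that α₀(1)⁻¹ α₀ is multiplicative.
  φ-mul : ∀ n m → φ n * φ m ≈ φ (n · m)
  φ-mul n m = *-cancelˡ (α-unit 1₈) (*-cancelˡ α₁-unit (begin
    β * (α₀ 1₈ * (φ n * φ m))     ≈⟨ *-congˡ (*-assoc _ _ _) ⟨
    β * (α₀ 1₈ * φ n * φ m)       ≈⟨ *-congˡ (*-congʳ (α₁φ n)) ⟩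
    β * (α₀ n * φ m)              ≈⟨ *-assoc _ _ _ ⟨
    β * α₀ n * φ m                ≈⟨ *-congʳ (reflexive (cong (λ k → β * α₀ k) (·-identityʳ n))) ⟨
    β * α₀ (n · 1₈) * φ m         ≈⟨ *-congʳ (α-mul n 1₈) ⟨
    α (# 1) n * α₀ 1₈ * φ m       ≈⟨ *-assoc _ _ _ ⟩
    α (# 1) n * (α₀ 1₈ * φ m)     ≈⟨ *-congˡ (α₁φ m) ⟩
    α (# 1) n * α₀ m              ≈⟨ α-mul n m ⟩
    β * α₀ (n · m)                ≈⟨ *-congˡ (α₁φ (n · m)) ⟨
    β * (α₀ 1₈ * φ (n · m))       ∎))
    where
    β = α (# 1) 1₈
    α₀ = α (# 0)

  -- Otherwise 1 and -1 would have the same α on side 0, and the chain of the cevian through the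
  -- point of 1 would vanish at the point of -1, which is not on that cevian.
  φ-minus-one≉1 : φ -1₈ ≉ 1#
  φ-minus-one≉1 p = nonzero l (on (# 0) -1₈) (λ ()) (α⇒vanishes (x l) (x∈ l) (# 0) -1₈ (begin
    coefficient (x l) (# 0)                  ≈⟨ vanishes⇒α (x l) (x∈ l) (# 0) 1₈ (zeros l (on (# 0) 1₈) refl) ⟩
    coefficient (x l) (# 1) * α (# 0) 1₈     ≈⟨ *-congˡ (begin
      α (# 0) 1₈                ≈⟨ *-identityʳ _ ⟨
      α (# 0) 1₈ * 1#           ≈⟨ *-congˡ p ⟨
      α (# 0) 1₈ * φ -1₈        ≈⟨ α₁φ -1₈ ⟩
      α (# 0) -1₈               ∎) ⟩
    coefficient (x l) (# 1) * α (# 0) -1₈    ∎))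
    where
    l = cevian (# 0) 1₈

  φ-minus-one : φ -1₈ ≈ - 1#
  φ-minus-one = square-one (≈-trans (φ-mul -1₈ -1₈) φ-one) φ-minus-one≉1

  φ-i² : φ (# 2) * φ (# 2) ≈ - 1#
  φ-i² = ≈-trans (φ-mul (# 2) (# 2)) φ-minus-one

  φ-j² : φ (# 4) * φ (# 4) ≈ - 1#
  φ-j² = ≈-trans (φ-mul (# 4) (# 4)) φ-minus-one

  φ-anticommute : φ (# 2) * φ (# 4) ≈ - (φ (# 4) * φ (# 2))
  φ-anticommute = begin
    φ (# 2) * φ (# 4)            ≈⟨ φ-mul (# 2) (# 4) ⟩
    -- `# 6` is k and `# 7` is -k, which equals j i.
    φ (# 6)                      ≈⟨ φ-mul -1₈ (# 7) ⟨
    φ -1₈ * φ (# 7)              ≈⟨ *-cong φ-minus-one (≈-sym (φ-mul (# 4) (# 2))) ⟩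
    - 1# * (φ (# 4) * φ (# 2))   ≈⟨ -‿distribˡ-* 1# _ ⟨
    - (1# * (φ (# 4) * φ (# 2))) ≈⟨ -‿cong (*-identityˡ _) ⟩
    - (φ (# 4) * φ (# 2))        ∎

not-representable : ∀ {c ℓ κ} (F : SkewField c ℓ) → ¬ RepresentableOverSF κ F M-R₉⊕Q₃
not-representable F representable =
  no-quaternions (R₉-characteristic.characteristic-3 isSkew realisation₁) (φ (# 2)) (φ (# 4)) φ-i² φ-j² φ-anticommute
  where
  isSkew = closure-isSkewField F
  open Summands F {M₁ = R₉} {M₂ = Q₃G} representable R₉-basis R₉-meets Q₃-basis Q₃-meets
  open SkewFieldArithmetic (¬¬-Closure.closure (SkewField.ring F)) isSkew using (no-quaternions)
  open Q₃-homomorphism isSkew realisation₂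

theorem3p37 : (Σ (SkewPartialField 0ℓ 0ℓ 0ℓ) λ P → RepresentableOverPF 0ℓ P M-R₉⊕Q₃)
    ∧ω (∀ {c ℓ κ : Level} (F : SkewField c ℓ) → ¬ RepresentableOverSF κ F M-R₉⊕Q₃)
theorem3p37 = (H₃-partialField , representable-over-H₃) ,ω not-representable
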